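{- Let $n,k,n',k'$ be integers with $\frac{n+1}{2}<k<n$, $n/k=n'/k'$, and $k,k'$ both even. Let $G$ and $G'$ be graphs with $H_{n,k}\subseteq G\subseteq H'_{n,k}$ and $H_{n',k'}\subseteq G'\subseteq H'_{n',k'}$. If there is a homomorphism $G\to G'$, then $n'$ and $k'$ are integer multiples of $n$ and $k$, respectively. Moreover, any such homomorphism is injective, and therefore $G$ is (isomorphic to) a subgraph of $G'$.
   Context: For integers $m\ge j$ with $j$ even, $H_{m,j}$ is the graph whose vertices are the even-weight elements of $\mathbb{Z}_2^m$, with $x\sim y$ iff the Hamming distance $d(x,y)$ equals $j$; and $H'_{m,j}$ is the graph on the same vertex set with $x\sim y$ iff $d(x,y)\ge j$. The inclusions $H_{m,j}\subseteq G\subseteq H'_{m,j}$ mean $G$ has the same vertex set and its edge set lies between the two edge sets. A homomorphism is an adjacency-preserving map between vertex sets. -}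

module Defs where

open import Data.Bool using (Bool; _xor_)
open import Data.Bool.Properties using (xor-comm; xor-same)
open import Data.Nat using (ℕ; _≤_; NonZero; ≢-nonZero⁻¹)
open import Data.Nat.Divisibility using (_∣_)
open import Data.Nat.Properties using (n≤0⇒n≡0)
open import Data.Product using (Σ-syntax)
open import Data.Refinement using (Refinement; value)
open import Data.Vec using (Vec; []; _∷_; countᵇ; zipWith)
open import Data.Vec.Properties using (zipWith-comm)
open import Function using (id; _↔_; _⇔_; Inverse)
open import Function.Definitions using (Injective)
open import Level using (0ℓ)
open import Relation.Binary using (Rel; Symmetric; _⇒_)
open import Relation.Binary.Morphism.Definitions using (Homomorphic₂)
open import Relation.Binary.PropositionalEquality using (_≡_; refl; sym; trans; cong; subst)
open import Relation.Nullary using (¬_)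
open import Relation.Unary using (Pred)

record Graph (V : Set) : Set₁ where
  field
    Adj    : Rel V 0ℓ
    symm   : Symmetric Adj
    irrefl : ∀ {x} → ¬ Adj x x

open Graph public

infix 4 _⊆_ _≅_

_⊆_ : {V : Set} → Graph V → Graph V → Set
G ⊆ H = Adj G ⇒ Adj H

record Hom {V W : Set} (G : Graph V) (H : Graph W) : Set where
  field
    fun       : V → W
    preserves : Homomorphic₂ V W (Adj G) (Adj H) fun

open Hom public

IsInjective : {V W : Set} {G : Graph V} {H : Graph W} → Hom G H → Set
IsInjective φ = Injective _≡_ _≡_ (fun φ)

record _≅_ {V W : Set} (G : Graph V) (H : Graph W) : Set where
  field
    bijection : V ↔ W
    adjacency : ∀ x y → Adj G x y ⇔ Adj H (Inverse.to bijection x) (Inverse.to bijection y)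

-- A not necessarily induced, not necessarily spanning subgraph. Membership
-- proofs are irrelevant in a refinement type, so distinct elements of it are
-- distinct vertices of the ambient graph.

record Subgraph {V : Set} (H : Graph V) : Set₁ where
  field
    vertices : Pred V 0ℓ
    graph    : Graph (Refinement V vertices)
    edges    : ∀ {x y} → Adj graph x y → Adj H (value x) (value y)

IsomorphicToSubgraphOf : {V W : Set} → Graph V → Graph W → Set₁
IsomorphicToSubgraphOf G H = Σ[ S ∈ Subgraph H ] (G ≅ Subgraph.graph S)

-- Elements of ℤ₂ᵐ are Boolean vectors, with true for 1 and addition given by
-- coordinatewise xor; hence d(x,y) is the weight of x + y.

weight : {m : ℕ} → Vec Bool m → ℕ
weight = countᵇ id

hamming : {m : ℕ} → Vec Bool m → Vec Bool m → ℕ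
hamming x y = weight (zipWith _xor_ x y)

EvenWeight : ℕ → Set
EvenWeight m = Refinement (Vec Bool m) (λ x → 2 ∣ weight x)

dist : {m : ℕ} → EvenWeight m → EvenWeight m → ℕ
dist x y = hamming (value x) (value y)

hamming-sym : {m : ℕ} (x y : Vec Bool m) → hamming x y ≡ hamming y x
hamming-sym x y = cong weight (zipWith-comm xor-comm x y)

hamming-refl : {m : ℕ} (x : Vec Bool m) → hamming x x ≡ 0
hamming-refl []      = refl
hamming-refl (b ∷ x) rewrite xor-same b = hamming-refl x

-- For j = 0 these relations would have loops, so j is required to be nonzero.

H : (m j : ℕ) .{{_ : NonZero j}} → Graph (EvenWeight m)
H m j = record
  { Adj    = λ x y → dist x y ≡ j
  ; symm   = λ {x} {y} p → trans (hamming-sym (value y) (value x)) p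
  ; irrefl = λ {x} p → ≢-nonZero⁻¹ j (trans (sym p) (hamming-refl (value x)))
  }

H′ : (m j : ℕ) .{{_ : NonZero j}} → Graph (EvenWeight m)
H′ m j = record
  { Adj    = λ x y → j ≤ dist x y
  ; symm   = λ {x} {y} p → subst (j ≤_) (hamming-sym (value x) (value y)) p
  ; irrefl = λ {x} p → ≢-nonZero⁻¹ j (n≤0⇒n≡0 (subst (j ≤_) (hamming-refl (value x)) p))
  }

{-# OPTIONS --safe #-}

-- A map from the even-weight vectors to ℤ₂ⁿ′ is a family of n′ functions f with values ±1, and n′
-- − 2 d(φx, φy) is the sum of the products f(x) f(y). For a homomorphism G → G′, this sum on each
-- edge of H n k is at most −(2k − n)/n times its value n′ at x = y, because n/k = n′/k′. On the
-- other hand the least eigenvalue of H n k is −(2k − n)/n times its degree, and since k > (n +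
-- 1)/2 it is attained only on the span of the n coordinate characters. So equality holds
-- everywhere: edges of H n k go to pairs at distance exactly k′, and each f is a combination of
-- coordinate characters. For fixed x the Gram function y ↦ n′ − 2 d(φx, φy) is then such a
-- combination and is constant on the neighbours x + A of x, |A| = k < n; exchanging one element
-- of A shows that its coefficients agree up to the signs of x, whence n d(φx, φy) = n′ d(x, y).
-- Injectivity follows, and a pair at distance 2, whose image has even distance, gives n ∣ n′.

module Submission where

open import Defs
open import Data.Bool using (Bool; true; false; _xor_; _∧_; not)
import Data.Bool.Properties as 𝔹
open import Data.Empty using (⊥-elim)
open import Data.Fin using (Fin; zero; suc)
open import Data.Integer as ℤ using (ℤ; +_; -[1+_]; 0ℤ; 1ℤ; -1ℤ)
import Data.Integer.Properties as ℤ
open import Data.Integer.Tactic.RingSolver using (solve-∀)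
open import Data.Irrelevant using ([_])
open import Data.List using (List; []; _∷_; _++_; map; length; allFin)
open import Data.List.Membership.Propositional using (_∈_; lose)
open import Data.List.Membership.Propositional.Properties
  using (∈-++⁺ˡ; ∈-++⁺ʳ; ∈-++⁻; ∈-map⁺; ∈-map⁻; ∈-allFin)
open import Data.List.Properties using (map-tabulate; length-++; length-map)
open import Data.List.Relation.Unary.Any using (here; there; any?; satisfied)
open import Data.Nat
  using (ℕ; zero; suc; _+_; _*_; _∸_; _^_; _≤_; _<_; z≤n; s≤s; NonZero; ≢-nonZero⁻¹)
open import Data.Nat.Divisibility using (_∣_; divides; divides-refl; _∣0; ∣m+n∣m⇒∣n; ∣1⇒≡1)
import Data.Nat.Properties as ℕ
import Data.Nat.Tactic.RingSolver as ℕ-Solver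
open import Data.Product using (Σ-syntax; ∃-syntax; _×_; _,_; proj₁; proj₂)
open import Data.Rational.Unnormalised using (_/_; _≃_; *<*; *≡*) renaming (_<_ to _<ℚ_)
open import Data.Refinement as Refinement using (Refinement; value; value-injective; _,_)
open import Data.Sum using (inj₁; inj₂; [_,_]′)
open import Data.Vec as Vec using (Vec; []; _∷_; zipWith; replicate; tail; lookup)
open import Data.Vec.Properties using (≡-dec)
open import Function using (_∘_; id; mk⇔; mk↔ₛ′)
open import Relation.Binary.PropositionalEquality
open import Relation.Nullary using (Dec; yes; no)
open import Relation.Nullary.Decidable using (map′; recompute)

-- Finite sums

-- The least eigenvalue is the hard step. Double counting exchanges the weight of a character with
-- the weight k of an edge, so the quantity to bound becomes a coefficient of (y - x)ᵏ(y + x)ˡ with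
-- l = n - k, and this polynomial equals (y² - x²)ˡ(y - x)ᵃ with a = 2k - n. Absolute values taken
-- in all linear factors separately would give only a binomial coefficient; keeping the l quadratic
-- factors together saves the required factor a/n. The hypothesis k > (n + 1)/2 says a ≥ 2: at a = 1
-- the comparison of the coefficients at x² degenerates to an equality, and strictness, which
-- isolates the coordinate characters, would be lost. The hypothesis k < n says l ≥ 1, so that there
-- is at least one quadratic factor. All of this stays in the integers: eigenvalues are multiplied
-- by n and Walsh expansions by 2ᴺ. Exponents of x and of y are both recorded, so that binomials and
-- Krawtchouk numbers need no truncated subtraction and their symmetry is visible.

∑ : {A : Set} → List A → (A → ℤ) → ℤ
∑ []       f = 0ℤ
∑ (x ∷ xs) f = f x ℤ.+ ∑ xs f

∑-cong-∈ : {A : Set} (xs : List A) {f g : A → ℤ} → (∀ {x} → x ∈ xs → f x ≡ g x) → ∑ xs f ≡ ∑ xs g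
∑-cong-∈ []       f≗g = refl
∑-cong-∈ (x ∷ xs) f≗g = cong₂ ℤ._+_ (f≗g (here refl)) (∑-cong-∈ xs (f≗g ∘ there))

∑-cong : {A : Set} (xs : List A) {f g : A → ℤ} → (∀ x → f x ≡ g x) → ∑ xs f ≡ ∑ xs g
∑-cong xs f≗g = ∑-cong-∈ xs (λ {x} _ → f≗g x)

∑-++ : {A : Set} (xs ys : List A) (f : A → ℤ) → ∑ (xs ++ ys) f ≡ ∑ xs f ℤ.+ ∑ ys f
∑-++ []       ys f = sym (ℤ.+-identityˡ _)
∑-++ (x ∷ xs) ys f = trans (cong (ℤ._+_ (f x)) (∑-++ xs ys f)) (sym (ℤ.+-assoc (f x) _ _))

∑-map : {A B : Set} (g : A → B) (xs : List A) (f : B → ℤ) → ∑ (map g xs) f ≡ ∑ xs (f ∘ g)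
∑-map g []       f = refl
∑-map g (x ∷ xs) f = cong (ℤ._+_ (f (g x))) (∑-map g xs f)

interchange : ∀ a b c d → (a ℤ.+ b) ℤ.+ (c ℤ.+ d) ≡ (a ℤ.+ c) ℤ.+ (b ℤ.+ d)
interchange = solve-∀

∑-+ : {A : Set} (xs : List A) (f g : A → ℤ) → ∑ xs (λ x → f x ℤ.+ g x) ≡ ∑ xs f ℤ.+ ∑ xs g
∑-+ []       f g = refl
∑-+ (x ∷ xs) f g = trans (cong (ℤ._+_ (f x ℤ.+ g x)) (∑-+ xs f g)) (interchange (f x) (g x) _ _)

∑-*ˡ : {A : Set} (xs : List A) (c : ℤ) (f : A → ℤ) → ∑ xs (λ x → c ℤ.* f x) ≡ c ℤ.* ∑ xs f
∑-*ˡ []       c f = sym (ℤ.*-zeroʳ c)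
∑-*ˡ (x ∷ xs) c f = trans (cong (ℤ._+_ (c ℤ.* f x)) (∑-*ˡ xs c f)) (sym (ℤ.*-distribˡ-+ c (f x) _))

∑-0 : {A : Set} (xs : List A) → ∑ xs (λ _ → 0ℤ) ≡ 0ℤ
∑-0 []       = refl
∑-0 (x ∷ xs) = trans (ℤ.+-identityˡ _) (∑-0 xs)

∑-const : {A : Set} (xs : List A) (c : ℤ) → ∑ xs (λ _ → c) ≡ + length xs ℤ.* c
∑-const []       c = refl
∑-const (x ∷ xs) c = trans (cong (ℤ._+_ c) (∑-const xs c)) (sym (ℤ.suc-* (+ length xs) c))

∑-swap : {A B : Set} (xs : List A) (ys : List B) (f : A → B → ℤ) →
         ∑ xs (λ x → ∑ ys (f x)) ≡ ∑ ys (λ y → ∑ xs (λ x → f x y))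
∑-swap []       ys f = sym (∑-0 ys)
∑-swap (x ∷ xs) ys f = trans (cong (ℤ._+_ (∑ ys (f x))) (∑-swap xs ys f)) (sym (∑-+ ys (f x) _))

∑-nonneg : {A : Set} (xs : List A) {f : A → ℤ} → (∀ {x} → x ∈ xs → 0ℤ ℤ.≤ f x) → 0ℤ ℤ.≤ ∑ xs f
∑-nonneg []       f≥0 = ℤ.≤-refl
∑-nonneg (x ∷ xs) f≥0 = ℤ.+-mono-≤ (f≥0 (here refl)) (∑-nonneg xs (f≥0 ∘ there))

nonneg-sum≡0 : ∀ {i j} → 0ℤ ℤ.≤ i → 0ℤ ℤ.≤ j → i ℤ.+ j ≡ 0ℤ → i ≡ 0ℤ × j ≡ 0ℤ
nonneg-sum≡0 {+ zero} {+ zero} _ _ _  = refl , refl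

∑-nonneg≡0 : {A : Set} (xs : List A) {f : A → ℤ} → (∀ {x} → x ∈ xs → 0ℤ ℤ.≤ f x) →
             ∑ xs f ≡ 0ℤ → ∀ {x} → x ∈ xs → f x ≡ 0ℤ
∑-nonneg≡0 (x ∷ xs) f≥0 ∑≡0 x∈
  with nonneg-sum≡0 (f≥0 (here refl)) (∑-nonneg xs (f≥0 ∘ there)) ∑≡0
∑-nonneg≡0 (x ∷ xs) f≥0 ∑≡0 (here refl) | fx≡0 , _    = fx≡0
∑-nonneg≡0 (x ∷ xs) f≥0 ∑≡0 (there x∈) | _    , rest = ∑-nonneg≡0 xs (f≥0 ∘ there) rest x∈

-- Walsh transform on ℤ₂ᴺ

infixl 6 _⊕_

_⊕_ : ∀ {m} → Vec Bool m → Vec Bool m → Vec Bool m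
_⊕_ = zipWith _xor_

𝟎 : ∀ {m} → Vec Bool m
𝟎 = replicate _ false

sgn : Bool → ℤ
sgn false = 1ℤ
sgn true  = -1ℤ

sgn-xor : ∀ a b → sgn (a xor b) ≡ sgn a ℤ.* sgn b
sgn-xor false b     = sym (ℤ.*-identityˡ _)
sgn-xor true  false = refl
sgn-xor true  true  = refl

χ : ∀ {m} → Vec Bool m → Vec Bool m → ℤ
χ []      []      = 1ℤ
χ (s ∷ S) (b ∷ y) = sgn (s ∧ b) ℤ.* χ S y

χ-comm : ∀ {m} (S y : Vec Bool m) → χ S y ≡ χ y S
χ-comm []          []          = refl
χ-comm (false ∷ S) (false ∷ y) = cong (ℤ._*_ 1ℤ) (χ-comm S y)
χ-comm (false ∷ S) (true  ∷ y) = cong (ℤ._*_ 1ℤ) (χ-comm S y)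
χ-comm (true  ∷ S) (false ∷ y) = cong (ℤ._*_ 1ℤ) (χ-comm S y)
χ-comm (true  ∷ S) (true  ∷ y) = cong (ℤ._*_ -1ℤ) (χ-comm S y)

χ-𝟎 : ∀ {m} (y : Vec Bool m) → χ 𝟎 y ≡ 1ℤ
χ-𝟎 []      = refl
χ-𝟎 (b ∷ y) = trans (ℤ.*-identityˡ _) (χ-𝟎 y)

⊕-identityʳ : ∀ {m} (y : Vec Bool m) → y ⊕ 𝟎 ≡ y
⊕-identityʳ []          = refl
⊕-identityʳ (false ∷ y) = cong (false ∷_) (⊕-identityʳ y)
⊕-identityʳ (true  ∷ y) = cong (true ∷_) (⊕-identityʳ y)

cube : ∀ m → List (Vec Bool m)
cube zero    = [] ∷ []
cube (suc m) = map (false ∷_) (cube m) ++ map (true ∷_) (cube m)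

∈-cube : ∀ {m} (x : Vec Bool m) → x ∈ cube m
∈-cube []          = here refl
∈-cube (false ∷ x) = ∈-++⁺ˡ (∈-map⁺ _ (∈-cube x))
∈-cube (true  ∷ x) = ∈-++⁺ʳ _ (∈-map⁺ _ (∈-cube x))

∑-∷ : ∀ {m} (xs ys : List (Vec Bool m)) (f : Vec Bool (suc m) → ℤ) →
      ∑ (map (false ∷_) xs ++ map (true ∷_) ys) f ≡ ∑ xs (f ∘ (false ∷_)) ℤ.+ ∑ ys (f ∘ (true ∷_))
∑-∷ xs ys f = trans (∑-++ (map (false ∷_) xs) _ f) (cong₂ ℤ._+_ (∑-map _ xs f) (∑-map _ ys f))

-- The unnormalised transform, the sum of f y times χ S y over the cube, computed by one butterfly
-- per coordinate so that the identities below go by induction on the dimension.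
walsh : ∀ {m} → (Vec Bool m → ℤ) → Vec Bool m → ℤ
walsh f []      = f []
walsh f (s ∷ S) = walsh (λ y → f (false ∷ y) ℤ.+ sgn s ℤ.* f (true ∷ y)) S

2^ : ℕ → ℤ
2^ m = + (2 ^ m)

2^-suc : ∀ m → 2^ (suc m) ≡ + 2 ℤ.* 2^ m
2^-suc m = ℤ.pos-* 2 (2 ^ m)

walsh-inversion : ∀ {m} (f : Vec Bool m → ℤ) z →
                  ∑ (cube m) (λ S → walsh f S ℤ.* χ S z) ≡ 2^ m ℤ.* f z
walsh-inversion {zero}  f []      = lem (f [])
  where
  lem : ∀ a → a ℤ.* 1ℤ ℤ.+ 0ℤ ≡ 1ℤ ℤ.* a
  lem = solve-∀
walsh-inversion {suc m} f (b ∷ z) = begin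
  ∑ (cube (suc m)) (λ S → walsh f S ℤ.* χ S (b ∷ z))
    ≡⟨ ∑-∷ (cube m) (cube m) _ ⟩
  ∑ (cube m) (λ S → walsh f₊ S ℤ.* (1ℤ ℤ.* χ S z)) ℤ.+
  ∑ (cube m) (λ S → walsh f₋ S ℤ.* (sgn b ℤ.* χ S z))
    ≡⟨ cong₂ ℤ._+_ (scaled 1ℤ f₊) (scaled (sgn b) f₋) ⟩
  1ℤ ℤ.* (2^ m ℤ.* f₊ z) ℤ.+ sgn b ℤ.* (2^ m ℤ.* f₋ z)
    ≡⟨ finish b ⟩
  + 2 ℤ.* 2^ m ℤ.* f (b ∷ z)
    ≡⟨ cong (ℤ._* f (b ∷ z)) (2^-suc m) ⟨
  2^ (suc m) ℤ.* f (b ∷ z) ∎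
  where
  open ≡-Reasoning
  f₊ f₋ : Vec Bool m → ℤ
  f₊ y = f (false ∷ y) ℤ.+ 1ℤ ℤ.* f (true ∷ y)
  f₋ y = f (false ∷ y) ℤ.+ -1ℤ ℤ.* f (true ∷ y)
  pull : ∀ a b c → a ℤ.* (b ℤ.* c) ≡ b ℤ.* (a ℤ.* c)
  pull = solve-∀
  scaled : ∀ c g → ∑ (cube m) (λ S → walsh g S ℤ.* (c ℤ.* χ S z)) ≡ c ℤ.* (2^ m ℤ.* g z)
  scaled c g = trans (∑-cong (cube m) (λ S → pull (walsh g S) c (χ S z)))
    (trans (∑-*ˡ (cube m) c _) (cong (ℤ._*_ c) (walsh-inversion g z)))
  plus : ∀ t u v → 1ℤ ℤ.* (t ℤ.* (u ℤ.+ 1ℤ ℤ.* v)) ℤ.+ 1ℤ ℤ.* (t ℤ.* (u ℤ.+ -1ℤ ℤ.* v)) ≡ + 2 ℤ.* t ℤ.* u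
  plus = solve-∀
  minus : ∀ t u v → 1ℤ ℤ.* (t ℤ.* (u ℤ.+ 1ℤ ℤ.* v)) ℤ.+ -1ℤ ℤ.* (t ℤ.* (u ℤ.+ -1ℤ ℤ.* v)) ≡ + 2 ℤ.* t ℤ.* v
  minus = solve-∀
  finish : ∀ b → 1ℤ ℤ.* (2^ m ℤ.* f₊ z) ℤ.+ sgn b ℤ.* (2^ m ℤ.* f₋ z) ≡ + 2 ℤ.* 2^ m ℤ.* f (b ∷ z)
  finish false = plus (2^ m) (f (false ∷ z)) (f (true ∷ z))
  finish true  = minus (2^ m) (f (false ∷ z)) (f (true ∷ z))

-- The Wiener-Khinchin identity; `B = 𝟎` gives Parseval. In each coordinate the mixed terms of `f₊`
-- and `f₋` cancel, as in a polarization identity.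
walsh-correlation : ∀ {m} (f : Vec Bool m → ℤ) B →
                    ∑ (cube m) (λ S → walsh f S ℤ.* walsh f S ℤ.* χ S B) ≡
                    2^ m ℤ.* ∑ (cube m) (λ y → f y ℤ.* f (y ⊕ B))
walsh-correlation {zero}  f []      = lem (f [])
  where
  lem : ∀ a → a ℤ.* a ℤ.* 1ℤ ℤ.+ 0ℤ ≡ 1ℤ ℤ.* (a ℤ.* a ℤ.+ 0ℤ)
  lem = solve-∀
walsh-correlation {suc m} f (b ∷ B) = begin
  ∑ (cube (suc m)) (λ S → walsh f S ℤ.* walsh f S ℤ.* χ S (b ∷ B))
    ≡⟨ ∑-∷ (cube m) (cube m) _ ⟩
  ∑ (cube m) (λ S → walsh f₊ S ℤ.* walsh f₊ S ℤ.* (1ℤ ℤ.* χ S B)) ℤ.+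
  ∑ (cube m) (λ S → walsh f₋ S ℤ.* walsh f₋ S ℤ.* (sgn b ℤ.* χ S B))
    ≡⟨ cong₂ ℤ._+_ (scaled 1ℤ f₊) (scaled (sgn b) f₋) ⟩
  ∑ (cube m) (λ y → 1ℤ ℤ.* (2^ m ℤ.* (f₊ y ℤ.* f₊ (y ⊕ B)))) ℤ.+
  ∑ (cube m) (λ y → sgn b ℤ.* (2^ m ℤ.* (f₋ y ℤ.* f₋ (y ⊕ B))))
    ≡⟨ ∑-+ (cube m) _ _ ⟨
  ∑ (cube m) (λ y → 1ℤ ℤ.* (2^ m ℤ.* (f₊ y ℤ.* f₊ (y ⊕ B))) ℤ.+
                    sgn b ℤ.* (2^ m ℤ.* (f₋ y ℤ.* f₋ (y ⊕ B))))
    ≡⟨ ∑-cong (cube m) (polarize b) ⟩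
  ∑ (cube m) (λ y → + 2 ℤ.* 2^ m ℤ.* (f (false ∷ y) ℤ.* f ((false ∷ y) ⊕ (b ∷ B)) ℤ.+
                                      f (true ∷ y) ℤ.* f ((true ∷ y) ⊕ (b ∷ B))))
    ≡⟨ ∑-*ˡ (cube m) (+ 2 ℤ.* 2^ m) _ ⟩
  + 2 ℤ.* 2^ m ℤ.* ∑ (cube m) (λ y → f (false ∷ y) ℤ.* f ((false ∷ y) ⊕ (b ∷ B)) ℤ.+
                                     f (true ∷ y) ℤ.* f ((true ∷ y) ⊕ (b ∷ B)))
    ≡⟨ cong₂ ℤ._*_ (2^-suc m) (trans (∑-∷ (cube m) (cube m) _) (sym (∑-+ (cube m) _ _))) ⟨
  2^ (suc m) ℤ.* ∑ (cube (suc m)) (λ y → f y ℤ.* f (y ⊕ (b ∷ B))) ∎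
  where
  open ≡-Reasoning
  f₊ f₋ : Vec Bool m → ℤ
  f₊ y = f (false ∷ y) ℤ.+ 1ℤ ℤ.* f (true ∷ y)
  f₋ y = f (false ∷ y) ℤ.+ -1ℤ ℤ.* f (true ∷ y)
  pull : ∀ a b c → a ℤ.* (b ℤ.* c) ≡ b ℤ.* (a ℤ.* c)
  pull = solve-∀
  scaled : ∀ c g → ∑ (cube m) (λ S → walsh g S ℤ.* walsh g S ℤ.* (c ℤ.* χ S B)) ≡
                   ∑ (cube m) (λ y → c ℤ.* (2^ m ℤ.* (g y ℤ.* g (y ⊕ B))))
  scaled c g = trans (∑-cong (cube m) (λ S → pull (walsh g S ℤ.* walsh g S) c (χ S B)))
    (trans (∑-*ˡ (cube m) c _) (trans (cong (ℤ._*_ c) (walsh-correlation g B))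
    (sym (trans (∑-*ˡ (cube m) c _) (cong (ℤ._*_ c) (∑-*ˡ (cube m) (2^ m) _))))))
  plus : ∀ t u v u′ v′ →
         1ℤ ℤ.* (t ℤ.* ((u ℤ.+ 1ℤ ℤ.* v) ℤ.* (u′ ℤ.+ 1ℤ ℤ.* v′))) ℤ.+
         1ℤ ℤ.* (t ℤ.* ((u ℤ.+ -1ℤ ℤ.* v) ℤ.* (u′ ℤ.+ -1ℤ ℤ.* v′))) ≡
         + 2 ℤ.* t ℤ.* (u ℤ.* u′ ℤ.+ v ℤ.* v′)
  plus = solve-∀
  minus : ∀ t u v u′ v′ →
          1ℤ ℤ.* (t ℤ.* ((u ℤ.+ 1ℤ ℤ.* v) ℤ.* (u′ ℤ.+ 1ℤ ℤ.* v′))) ℤ.+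
          -1ℤ ℤ.* (t ℤ.* ((u ℤ.+ -1ℤ ℤ.* v) ℤ.* (u′ ℤ.+ -1ℤ ℤ.* v′))) ≡
          + 2 ℤ.* t ℤ.* (u ℤ.* v′ ℤ.+ v ℤ.* u′)
  minus = solve-∀
  polarize : ∀ b y →
    1ℤ ℤ.* (2^ m ℤ.* (f₊ y ℤ.* f₊ (y ⊕ B))) ℤ.+ sgn b ℤ.* (2^ m ℤ.* (f₋ y ℤ.* f₋ (y ⊕ B))) ≡
    + 2 ℤ.* 2^ m ℤ.* (f (false ∷ y) ℤ.* f ((false ∷ y) ⊕ (b ∷ B)) ℤ.+
                      f (true ∷ y) ℤ.* f ((true ∷ y) ⊕ (b ∷ B)))
  polarize false y = plus (2^ m) (f (false ∷ y)) (f (true ∷ y)) (f (false ∷ (y ⊕ B))) (f (true ∷ (y ⊕ B)))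
  polarize true  y = minus (2^ m) (f (false ∷ y)) (f (true ∷ y)) (f (false ∷ (y ⊕ B))) (f (true ∷ (y ⊕ B)))

-- Krawtchouk numbers

-- A function c : ℕ → ℕ → A stands for the polynomial in x and y whose
-- coefficient at xᵏyˡ is c k l, so these are multiplication by x and by y.

x· y· : {A : Set} → A → (ℕ → ℕ → A) → ℕ → ℕ → A
x· o c zero    l = o
x· o c (suc k) l = c k l
y· o c k zero    = o
y· o c k (suc l) = c k l

x·-cong : ∀ {A : Set} {o : A} {c d} → (∀ k l → c k l ≡ d k l) → ∀ k l → x· o c k l ≡ x· o d k l
x·-cong c≗d zero    l = refl
x·-cong c≗d (suc k) l = c≗d k l

y·-cong : ∀ {A : Set} {o : A} {c d} → (∀ k l → c k l ≡ d k l) → ∀ k l → y· o c k l ≡ y· o d k l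
y·-cong c≗d k zero    = refl
y·-cong c≗d k (suc l) = c≗d k l

x·y· : ∀ {A : Set} {o : A} c k l → x· o (y· o c) k l ≡ y· o (x· o c) k l
x·y· c zero    zero    = refl
x·y· c zero    (suc l) = refl
x·y· c (suc k) zero    = refl
x·y· c (suc k) (suc l) = refl

-- Multiplication by y + s x.

step : ℤ → (ℕ → ℕ → ℤ) → ℕ → ℕ → ℤ
step s c k l = y· 0ℤ c k l ℤ.+ s ℤ.* x· 0ℤ c k l

step-cong : ∀ s {c d} → (∀ k l → c k l ≡ d k l) → ∀ k l → step s c k l ≡ step s d k l
step-cong s c≗d k l = cong₂ (λ u v → u ℤ.+ s ℤ.* v) (y·-cong c≗d k l) (x·-cong c≗d k l)

x·-step : ∀ s c k l → x· 0ℤ (step s c) k l ≡ step s (x· 0ℤ c) k l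
x·-step s c zero    zero    = sym (trans (ℤ.+-identityˡ _) (ℤ.*-zeroʳ s))
x·-step s c zero    (suc l) = sym (trans (ℤ.+-identityˡ _) (ℤ.*-zeroʳ s))
x·-step s c (suc k) zero    = refl
x·-step s c (suc k) (suc l) = refl

y·-step : ∀ s c k l → y· 0ℤ (step s c) k l ≡ step s (y· 0ℤ c) k l
y·-step s c zero    zero    = sym (trans (ℤ.+-identityˡ _) (ℤ.*-zeroʳ s))
y·-step s c zero    (suc l) = refl
y·-step s c (suc k) zero    = sym (trans (ℤ.+-identityˡ _) (ℤ.*-zeroʳ s))
y·-step s c (suc k) (suc l) = refl

-- The expansion is symmetric in s and t, so the linear factors commute. For s = -1 and t = 1 the
-- mixed term vanishes and the factor y² - x² remains.
step-step : ∀ s t c k l → step s (step t c) k l ≡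
  (y· 0ℤ (y· 0ℤ c) k l ℤ.+ (s ℤ.+ t) ℤ.* x· 0ℤ (y· 0ℤ c) k l) ℤ.+ s ℤ.* t ℤ.* x· 0ℤ (x· 0ℤ c) k l
step-step s t c k l = trans
  (cong₂ (λ u v → u ℤ.+ s ℤ.* v) (y·-step t c k l)
    (trans (x·-step t c k l) (cong (λ u → u ℤ.+ t ℤ.* x· 0ℤ (x· 0ℤ c) k l) (sym (x·y· c k l)))))
  (expand s t (y· 0ℤ (y· 0ℤ c) k l) (x· 0ℤ (y· 0ℤ c) k l) (x· 0ℤ (x· 0ℤ c) k l))
  where
  expand : ∀ s t a b d → (a ℤ.+ t ℤ.* b) ℤ.+ s ℤ.* (b ℤ.+ t ℤ.* d) ≡ (a ℤ.+ (s ℤ.+ t) ℤ.* b) ℤ.+ s ℤ.* t ℤ.* d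
  expand = solve-∀

step-comm : ∀ s t c k l → step s (step t c) k l ≡ step t (step s c) k l
step-comm s t c k l = trans (step-step s t c k l) (trans
  (cong₂ (λ u v → (y· 0ℤ (y· 0ℤ c) k l ℤ.+ u ℤ.* x· 0ℤ (y· 0ℤ c) k l) ℤ.+ v ℤ.* x· 0ℤ (x· 0ℤ c) k l)
    (ℤ.+-comm s t) (ℤ.*-comm s t))
  (sym (step-step t s c k l)))

-- krawtchouk p q k l is the coefficient of xᵏyˡ in (y − x)ᵖ(y + x)^q.

krawtchouk : ℕ → ℕ → ℕ → ℕ → ℤ
krawtchouk zero    zero    zero zero = 1ℤ
krawtchouk zero    zero    _    _    = 0ℤ
krawtchouk zero    (suc q) = step 1ℤ (krawtchouk zero q)
krawtchouk (suc p) q       = step -1ℤ (krawtchouk p q)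

krawtchouk-sucʳ : ∀ p q k l → krawtchouk p (suc q) k l ≡ step 1ℤ (krawtchouk p q) k l
krawtchouk-sucʳ zero    q k l = refl
krawtchouk-sucʳ (suc p) q k l =
  trans (step-cong -1ℤ (krawtchouk-sucʳ p q) k l) (step-comm -1ℤ 1ℤ (krawtchouk p q) k l)

krawtchouk-suc-suc : ∀ p q k l → krawtchouk (suc p) (suc q) k l ≡
  y· 0ℤ (y· 0ℤ (krawtchouk p q)) k l ℤ.- x· 0ℤ (x· 0ℤ (krawtchouk p q)) k l
krawtchouk-suc-suc p q k l = trans (step-cong -1ℤ (krawtchouk-sucʳ p q) k l)
  (trans (step-step -1ℤ 1ℤ (krawtchouk p q) k l)
    (simplify (y· 0ℤ (y· 0ℤ c) k l) (x· 0ℤ (y· 0ℤ c) k l) (x· 0ℤ (x· 0ℤ c) k l)))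
  where
  c = krawtchouk p q
  simplify : ∀ a b d → (a ℤ.+ (-1ℤ ℤ.+ 1ℤ) ℤ.* b) ℤ.+ -1ℤ ℤ.* 1ℤ ℤ.* d ≡ a ℤ.- d
  simplify = solve-∀

zeros : ∀ {m} → Vec Bool m → ℕ
zeros []          = 0
zeros (false ∷ x) = suc (zeros x)
zeros (true  ∷ x) = zeros x

weight+zeros : ∀ {m} (x : Vec Bool m) → weight x + zeros x ≡ m
weight+zeros []          = refl
weight+zeros (false ∷ x) = trans (ℕ.+-suc (weight x) (zeros x)) (cong suc (weight+zeros x))
weight+zeros (true  ∷ x) = cong suc (weight+zeros x)

-- The vectors with k coordinates true and l coordinates false, so none unless k + l = m.

layer : ∀ m → ℕ → ℕ → List (Vec Bool m)
layer zero    zero zero = [] ∷ []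
layer zero    _    _    = []
layer (suc m) k    l    = map (false ∷_) (y· [] (layer m) k l) ++ map (true ∷_) (x· [] (layer m) k l)

∈-layer : ∀ {m} (x : Vec Bool m) → x ∈ layer m (weight x) (zeros x)
∈-layer []          = here refl
∈-layer (false ∷ x) = ∈-++⁺ˡ (∈-map⁺ _ (∈-layer x))
∈-layer (true  ∷ x) = ∈-++⁺ʳ _ (∈-map⁺ _ (∈-layer x))

∈-layer⁻ : ∀ {m} k l {x : Vec Bool m} → x ∈ layer m k l → weight x ≡ k × zeros x ≡ l
∈-layer⁻ {zero}  zero zero (here refl) = refl , refl
∈-layer⁻ {suc m} k    l    x∈ with ∈-++⁻ (map (false ∷_) (y· [] (layer m) k l)) x∈
∈-layer⁻ {suc m} k       (suc l) _ | inj₁ x∈ with ∈-map⁻ (false ∷_) x∈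
... | _ , x′∈ , refl = proj₁ (∈-layer⁻ k l x′∈) , cong suc (proj₂ (∈-layer⁻ k l x′∈))
∈-layer⁻ {suc m} (suc k) l       _ | inj₂ x∈ with ∈-map⁻ (true ∷_) x∈
... | _ , x′∈ , refl = cong suc (proj₁ (∈-layer⁻ k l x′∈)) , proj₂ (∈-layer⁻ k l x′∈)

-- These character sums are the eigenvalues of the Cayley graph generated by the layer. A coordinate
-- outside S contributes the factor y + x to their generating polynomial, a coordinate in S the
-- factor y - x.
∑-layer-χ : ∀ {m} (S : Vec Bool m) k l → ∑ (layer m k l) (χ S) ≡ krawtchouk (weight S) (zeros S) k l
∑-layer-χ []      zero    zero    = refl
∑-layer-χ []      zero    (suc l) = refl
∑-layer-χ []      (suc k) zero    = refl
∑-layer-χ []      (suc k) (suc l) = refl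
∑-layer-χ {suc m} (s ∷ S) k l = trans (∑-∷ (y· [] (layer m) k l) (x· [] (layer m) k l) (χ (s ∷ S)))
  (trans (cong₂ ℤ._+_ (trans (∑-*ˡ (y· [] (layer m) k l) (sgn (s ∧ false)) (χ S)) (cong₂ ℤ._*_ (cong sgn (∧-false s)) (y-part k l)))
                      (trans (∑-*ˡ (x· [] (layer m) k l) (sgn (s ∧ true)) (χ S)) (cong (ℤ._*_ (sgn (s ∧ true))) (x-part k l))))
         (absorb s))
  where
  c = krawtchouk (weight S) (zeros S)
  ∧-false : ∀ s → s ∧ false ≡ false
  ∧-false false = refl
  ∧-false true  = refl
  y-part : ∀ k l → ∑ (y· [] (layer m) k l) (χ S) ≡ y· 0ℤ c k l
  y-part k zero    = refl
  y-part k (suc l) = ∑-layer-χ S k l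
  x-part : ∀ k l → ∑ (x· [] (layer m) k l) (χ S) ≡ x· 0ℤ c k l
  x-part zero    l = refl
  x-part (suc k) l = ∑-layer-χ S k l
  absorb : ∀ s → sgn false ℤ.* y· 0ℤ c k l ℤ.+ sgn (s ∧ true) ℤ.* x· 0ℤ c k l ≡
           krawtchouk (weight (s ∷ S)) (zeros (s ∷ S)) k l
  absorb false = trans (cong (ℤ._+ 1ℤ ℤ.* x· 0ℤ c k l) (ℤ.*-identityˡ (y· 0ℤ c k l))) (sym (krawtchouk-sucʳ (weight S) (zeros S) k l))
  absorb true  = cong (ℤ._+ -1ℤ ℤ.* x· 0ℤ c k l) (ℤ.*-identityˡ (y· 0ℤ c k l))

-- Binomial coefficients, with `binomial j l` standing for (j + l)! / (j! l!)

binomial : ℕ → ℕ → ℕ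
binomial zero    l       = 1
binomial (suc j) zero    = 1
binomial (suc j) (suc l) = binomial j (suc l) + binomial (suc j) l

binomial-0ʳ : ∀ j → binomial j 0 ≡ 1
binomial-0ʳ zero    = refl
binomial-0ʳ (suc j) = refl

binomial-comm : ∀ j l → binomial j l ≡ binomial l j
binomial-comm zero    l       = sym (binomial-0ʳ l)
binomial-comm (suc j) zero    = refl
binomial-comm (suc j) (suc l) = trans (cong₂ _+_ (binomial-comm j (suc l)) (binomial-comm (suc j) l))
  (ℕ.+-comm (binomial (suc l) j) (binomial l (suc j)))

binomial>0 : ∀ j l → 0 < binomial j l
binomial>0 zero    l       = s≤s z≤n
binomial>0 (suc j) zero    = s≤s z≤n
binomial>0 (suc j) (suc l) = ℕ.<-≤-trans (binomial>0 j (suc l)) (ℕ.m≤m+n _ _)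

binomial-absorbˡ : ∀ j l → suc j * binomial (suc j) l ≡ suc (j + l) * binomial j l
binomial-absorbˡ zero    zero    = refl
binomial-absorbˡ (suc j) zero    = cong (λ t → suc t * 1) (sym (ℕ.+-identityʳ (suc j)))
binomial-absorbˡ zero    (suc l) = trans (cong (λ t → 1 * (1 + t)) (trans (sym (ℕ.+-identityʳ _)) (binomial-absorbˡ zero l)))
  (lem l)
  where
  lem : ∀ l → 1 * (1 + suc l * 1) ≡ suc (suc l) * 1
  lem = ℕ-Solver.solve-∀
binomial-absorbˡ (suc j) (suc l) = begin
  suc (suc j) * (b₁ + b₂)                   ≡⟨ split j b₁ b₂ ⟩
  b₁ + suc j * b₁ + suc (suc j) * b₂
    ≡⟨ cong₂ (λ u v → b₁ + u + v) (binomial-absorbˡ j (suc l)) (binomial-absorbˡ (suc j) l) ⟩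
  b₁ + suc (j + suc l) * binomial j (suc l) + suc (suc j + l) * binomial (suc j) l
    ≡⟨ merge j l (binomial j (suc l)) (binomial (suc j) l) ⟩
  suc (suc j + suc l) * b₁ ∎
  where
  open ≡-Reasoning
  b₁ = binomial (suc j) (suc l)
  b₂ = binomial (suc (suc j)) l
  split : ∀ j u v → suc (suc j) * (u + v) ≡ u + suc j * u + suc (suc j) * v
  split = ℕ-Solver.solve-∀
  merge : ∀ j l u v → (u + v) + suc (j + suc l) * u + suc (suc j + l) * v ≡ suc (suc j + suc l) * (u + v)
  merge = ℕ-Solver.solve-∀

binomial-absorbʳ : ∀ j l → suc l * binomial j (suc l) ≡ suc (j + l) * binomial j l
binomial-absorbʳ j l = begin
  suc l * binomial j (suc l)    ≡⟨ cong (suc l *_) (binomial-comm j (suc l)) ⟩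
  suc l * binomial (suc l) j    ≡⟨ binomial-absorbˡ l j ⟩
  suc (l + j) * binomial l j    ≡⟨ cong₂ (λ u v → suc u * v) (ℕ.+-comm l j) (binomial-comm l j) ⟩
  suc (j + l) * binomial j l    ∎
  where open ≡-Reasoning

-- Absorption in each index once. It relates a binomial to the one two rows below, which is the
-- comparison that the strict inductive step needs.
binomial-diagonal : ∀ j l → (2 + (j + l)) * (1 + (j + l)) * binomial j l ≡ suc j * suc l * binomial (suc j) (suc l)
binomial-diagonal j l = begin
  (2 + (j + l)) * (1 + (j + l)) * binomial j l        ≡⟨ ℕ.*-assoc (2 + (j + l)) (1 + (j + l)) (binomial j l) ⟩
  (2 + (j + l)) * ((1 + (j + l)) * binomial j l)      ≡⟨ cong ((2 + (j + l)) *_) (binomial-absorbˡ j l) ⟨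
  (2 + (j + l)) * (suc j * binomial (suc j) l)        ≡⟨ pull j l (binomial (suc j) l) ⟩
  suc j * (suc (suc j + l) * binomial (suc j) l)      ≡⟨ cong (suc j *_) (binomial-absorbʳ (suc j) l) ⟨
  suc j * (suc l * binomial (suc j) (suc l))          ≡⟨ ℕ.*-assoc (suc j) (suc l) _ ⟨
  suc j * suc l * binomial (suc j) (suc l)            ∎
  where
  open ≡-Reasoning
  pull : ∀ j l b → (2 + (j + l)) * (suc j * b) ≡ suc j * (suc (suc j + l) * b)
  pull = ℕ-Solver.solve-∀

-- majorant i a k l is the coefficient of xᵏyˡ in (y² + x²)ⁱ(y + x)ᵃ, which dominates
-- coefficientwise (y − x)ⁱ⁺ᵃ(y + x)ⁱ = (y² − x²)ⁱ(y − x)ᵃ.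

majorant : ℕ → ℕ → ℕ → ℕ → ℕ
majorant zero    zero    zero zero = 1
majorant zero    zero    _    _    = 0
majorant zero    (suc a) k    l    = y· 0 (majorant zero a) k l + x· 0 (majorant zero a) k l
majorant (suc i) a       k    l    = y· 0 (y· 0 (majorant i a)) k l + x· 0 (x· 0 (majorant i a)) k l

x·-comm : ∀ {c : ℕ → ℕ → ℕ} → (∀ k l → c k l ≡ c l k) → ∀ k l → x· 0 c k l ≡ y· 0 c l k
x·-comm sym-c zero    l = refl
x·-comm sym-c (suc k) l = sym-c k l

majorant-comm : ∀ i a k l → majorant i a k l ≡ majorant i a l k
majorant-comm zero zero    zero    zero    = refl
majorant-comm zero zero    zero    (suc l) = refl
majorant-comm zero zero    (suc k) zero    = refl
majorant-comm zero zero    (suc k) (suc l) = refl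
majorant-comm zero (suc a) k l =
  trans (ℕ.+-comm _ (x· 0 (majorant zero a) k l))
        (cong₂ _+_ (x·-comm (majorant-comm zero a) k l) (sym (x·-comm (majorant-comm zero a) l k)))
majorant-comm (suc i) a k l =
  trans (ℕ.+-comm _ (x· 0 (x· 0 (majorant i a)) k l)) (cong₂ _+_ (twice k l) (sym (twice l k)))
  where
  twice : ∀ k l → x· 0 (x· 0 (majorant i a)) k l ≡ y· 0 (y· 0 (majorant i a)) l k
  twice zero    l = refl
  twice (suc k) l = x·-comm (majorant-comm i a) k l

length-layer : ∀ m k l → length (layer m k l) ≡ majorant 0 m k l
length-layer zero    zero    zero    = refl
length-layer zero    zero    (suc l) = refl
length-layer zero    (suc k) zero    = refl
length-layer zero    (suc k) (suc l) = refl
length-layer (suc m) k       l       = trans (length-++ (map (false ∷_) (y· [] (layer m) k l)))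
  (cong₂ _+_ (trans (length-map (false ∷_) (y· [] (layer m) k l)) (y-part k l))
             (trans (length-map (true ∷_) (x· [] (layer m) k l)) (x-part k l)))
  where
  y-part : ∀ k l → length (y· [] (layer m) k l) ≡ y· 0 (majorant 0 m) k l
  y-part k zero    = refl
  y-part k (suc l) = length-layer m k l
  x-part : ∀ k l → length (x· [] (layer m) k l) ≡ x· 0 (majorant 0 m) k l
  x-part zero    l = refl
  x-part (suc k) l = length-layer m k l

majorant-binomial : ∀ m k l → k + l ≡ m → majorant 0 m k l ≡ binomial k l
majorant-binomial zero    zero    zero    _  = refl
majorant-binomial (suc m) zero    (suc l) eq =
  trans (ℕ.+-identityʳ _) (majorant-binomial m zero l (ℕ.suc-injective eq))
majorant-binomial (suc m) (suc k) zero    eq =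
  trans (majorant-binomial m k zero (ℕ.suc-injective eq)) (binomial-0ʳ k)
majorant-binomial (suc m) (suc k) (suc l) eq = trans
  (cong₂ _+_ (majorant-binomial m (suc k) l (trans (sym (ℕ.+-suc k l)) (ℕ.suc-injective eq)))
             (majorant-binomial m k (suc l) (ℕ.suc-injective eq)))
  (ℕ.+-comm (binomial (suc k) l) (binomial k (suc l)))

length-layer-binomial : ∀ {m} k l → k + l ≡ m → length (layer m k l) ≡ binomial k l
length-layer-binomial {m} k l eq = trans (length-layer m k l) (majorant-binomial m k l eq)

-- Double counting of ∑ χ S A over the pairs (S, A) with S of type (p , q) and A of type (k , l).

krawtchouk-duality : ∀ {m} p q k l → p + q ≡ m → k + l ≡ m →
  + binomial p q ℤ.* krawtchouk p q k l ≡ + binomial k l ℤ.* krawtchouk k l p q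
krawtchouk-duality {m} p q k l p+q≡m k+l≡m = begin
  + binomial p q ℤ.* krawtchouk p q k l                ≡⟨ count p q k l p+q≡m ⟨
  ∑ (layer m p q) (λ S → ∑ (layer m k l) (χ S))        ≡⟨ ∑-swap (layer m p q) (layer m k l) χ ⟩
  ∑ (layer m k l) (λ A → ∑ (layer m p q) (λ S → χ S A))
    ≡⟨ ∑-cong (layer m k l) (λ A → ∑-cong (layer m p q) (λ S → χ-comm S A)) ⟩
  ∑ (layer m k l) (λ A → ∑ (layer m p q) (χ A))        ≡⟨ count k l p q k+l≡m ⟩
  + binomial k l ℤ.* krawtchouk k l p q                ∎
  where
  open ≡-Reasoning
  count : ∀ p q k l → p + q ≡ m →
          ∑ (layer m p q) (λ S → ∑ (layer m k l) (χ S)) ≡ + binomial p q ℤ.* krawtchouk p q k l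
  count p q k l eq = begin
    ∑ (layer m p q) (λ S → ∑ (layer m k l) (χ S))
      ≡⟨ ∑-cong-∈ (layer m p q) (λ {S} S∈ → trans (∑-layer-χ S k l)
           (cong₂ (λ u v → krawtchouk u v k l) (proj₁ (∈-layer⁻ p q S∈)) (proj₂ (∈-layer⁻ p q S∈)))) ⟩
    ∑ (layer m p q) (λ _ → krawtchouk p q k l)         ≡⟨ ∑-const (layer m p q) _ ⟩
    + length (layer m p q) ℤ.* krawtchouk p q k l
      ≡⟨ cong (λ t → + t ℤ.* krawtchouk p q k l) (length-layer-binomial p q eq) ⟩
    + binomial p q ℤ.* krawtchouk p q k l              ∎

∣x·∣ : ∀ {c d} → (∀ k l → ℤ.∣ c k l ∣ ≤ d k l) → ∀ k l → ℤ.∣ x· 0ℤ c k l ∣ ≤ x· 0 d k l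
∣x·∣ c≤d zero    l = z≤n
∣x·∣ c≤d (suc k) l = c≤d k l

∣y·∣ : ∀ {c d} → (∀ k l → ℤ.∣ c k l ∣ ≤ d k l) → ∀ k l → ℤ.∣ y· 0ℤ c k l ∣ ≤ y· 0 d k l
∣y·∣ c≤d k zero    = z≤n
∣y·∣ c≤d k (suc l) = c≤d k l

-- The triangle inequality, applied once to each factor y² - x² as a whole and once to each of the
-- `a` surplus factors y - x.
∣krawtchouk∣≤majorant : ∀ i a k l → ℤ.∣ krawtchouk (i + a) i k l ∣ ≤ majorant i a k l
∣krawtchouk∣≤majorant zero zero    zero    zero    = ℕ.≤-refl
∣krawtchouk∣≤majorant zero zero    zero    (suc l) = z≤n
∣krawtchouk∣≤majorant zero zero    (suc k) zero    = z≤n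
∣krawtchouk∣≤majorant zero zero    (suc k) (suc l) = z≤n
∣krawtchouk∣≤majorant zero (suc a) k l = ℕ.≤-trans (ℤ.∣i+j∣≤∣i∣+∣j∣ (y· 0ℤ c k l) (-1ℤ ℤ.* x· 0ℤ c k l))
  (ℕ.+-mono-≤ (∣y·∣ (∣krawtchouk∣≤majorant zero a) k l)
    (subst (_≤ x· 0 (majorant zero a) k l)
      (sym (trans (ℤ.abs-* -1ℤ (x· 0ℤ c k l)) (ℕ.*-identityˡ _)))
      (∣x·∣ (∣krawtchouk∣≤majorant zero a) k l)))
  where c = krawtchouk a zero
∣krawtchouk∣≤majorant (suc i) a k l = subst (λ t → ℤ.∣ t ∣ ≤ majorant (suc i) a k l)
  (sym (krawtchouk-suc-suc (i + a) i k l))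
  (ℕ.≤-trans (ℤ.∣i-j∣≤∣i∣+∣j∣ (y· 0ℤ (y· 0ℤ c) k l) (x· 0ℤ (x· 0ℤ c) k l))
    (ℕ.+-mono-≤ (∣y·∣ (∣y·∣ (∣krawtchouk∣≤majorant i a)) k l) (∣x·∣ (∣x·∣ (∣krawtchouk∣≤majorant i a)) k l)))
  where c = krawtchouk (i + a) i

-- Coefficients of the majorant at 1, x and x²

y·-≤ : ∀ {c : ℕ → ℕ → ℕ} {k u} → (∀ l → c k l ≤ u) → ∀ l → y· 0 c k l ≤ u
y·-≤ c≤u zero    = z≤n
y·-≤ c≤u (suc l) = c≤u l

-- The exponent of y may be arbitrary: the polynomial is homogeneous, so a wrong total degree only
-- makes the coefficient zero.
majorant-0 : ∀ i a l → majorant i a 0 l ≤ 1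
majorant-0 zero    zero    zero    = ℕ.≤-refl
majorant-0 zero    zero    (suc l) = z≤n
majorant-0 zero    (suc a) l       =
  subst (_≤ 1) (sym (ℕ.+-identityʳ _)) (y·-≤ {majorant zero a} {0} (majorant-0 zero a) l)
majorant-0 (suc i) a       l       =
  subst (_≤ 1) (sym (ℕ.+-identityʳ _)) (y·-≤ {y· 0 (majorant i a)} {0} (y·-≤ {majorant i a} {0} (majorant-0 i a)) l)

majorant-1 : ∀ i a l → majorant i a 1 l ≤ a
majorant-1 zero    zero    l = z≤n
majorant-1 zero    (suc a) l = subst (y· 0 (majorant zero a) 1 l + majorant zero a 0 l ≤_) (ℕ.+-comm a 1)
  (ℕ.+-mono-≤ (y·-≤ {majorant zero a} {1} (majorant-1 zero a) l) (majorant-0 zero a l))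
majorant-1 (suc i) a       l =
  subst (_≤ a) (sym (ℕ.+-identityʳ _)) (y·-≤ {y· 0 (majorant i a)} {1} (y·-≤ {majorant i a} {1} (majorant-1 i a)) l)

n≤n*n : ∀ n → n ≤ n * n
n≤n*n zero    = z≤n
n≤n*n (suc n) = ℕ.m≤m*n (suc n) (suc n)

-- In the right degree the coefficient is i + a(a - 1)/2; doubling it and moving a to the left
-- avoids division and subtraction.
majorant-2 : ∀ i a l → 2 * majorant i a 2 l + a ≤ 2 * i + a * a
majorant-2 zero    zero    l = z≤n
majorant-2 zero    (suc a) l = subst₂ _≤_
  (regroup a (y· 0 (majorant zero a) 2 l) (majorant zero a 1 l)) (square a)
  (ℕ.+-mono-≤ (ℕ.+-mono-≤ (earlier l) (ℕ.*-monoʳ-≤ 2 (majorant-1 zero a l))) (ℕ.≤-refl {1}))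
  where
  earlier : ∀ l → 2 * y· 0 (majorant zero a) 2 l + a ≤ a * a
  earlier zero    = n≤n*n a
  earlier (suc l) = majorant-2 zero a l
  regroup : ∀ a u v → 2 * u + a + 2 * v + 1 ≡ 2 * (u + v) + suc a
  regroup = ℕ-Solver.solve-∀
  square : ∀ a → a * a + 2 * a + 1 ≡ suc a * suc a
  square = ℕ-Solver.solve-∀
majorant-2 (suc i) a       l = subst₂ _≤_
  (regroup a (y· 0 (y· 0 (majorant i a)) 2 l) (majorant i a 0 l)) (double i (a * a))
  (ℕ.+-mono-≤ (earlier l) (ℕ.*-monoʳ-≤ 2 (majorant-0 i a l)))
  where
  a≤ : a ≤ 2 * i + a * a
  a≤ = ℕ.≤-trans (n≤n*n a) (ℕ.m≤n+m _ _)
  earlier : ∀ l → 2 * y· 0 (y· 0 (majorant i a)) 2 l + a ≤ 2 * i + a * a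
  earlier zero          = a≤
  earlier (suc zero)    = a≤
  earlier (suc (suc l)) = majorant-2 i a l
  regroup : ∀ a u v → 2 * u + a + 2 * v ≡ 2 * (u + v) + a
  regroup = ℕ-Solver.solve-∀
  double : ∀ i b → 2 * i + b + 2 * 1 ≡ 2 * suc i + b
  double = ℕ-Solver.solve-∀

-- Comparison of the majorant with the binomial coefficients

binomial-1 : ∀ l → binomial 1 l ≡ suc l
binomial-1 zero    = refl
binomial-1 (suc l) = cong suc (binomial-1 l)

binomial-2 : ∀ l → 2 * binomial 2 l ≡ suc l * suc (suc l)
binomial-2 l = trans (binomial-absorbˡ 1 l) (trans (cong (suc (suc l) *_) (binomial-1 l)) (ℕ.*-comm (suc (suc l)) (suc l)))

-- After doubling and removing the common factor n = 4 + l, the claim reads 2(i + 1) + a(a - 1) <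
-- a(n - 1). The two sides differ by 2(i + 1)(a - 1), so this is where `2 ≤ a` is decisive.
majorant<binomial-2 : ∀ i a l → 2 ≤ a → 2 + (2 + l) ≡ 2 * suc i + a →
  (2 * suc i + a) * majorant (suc i) a 2 (2 + l) < a * binomial 2 (2 + l)
majorant<binomial-2 i (suc zero)    l (s≤s ()) eq
majorant<binomial-2 i (suc (suc a)) l _ eq = ℕ.*-cancelˡ-< 2 _ _ (begin-strict
  2 * ((2 * suc i + A) * M)                ≡⟨ pull (2 * suc i + A) M ⟩
  (2 * suc i + A) * (2 * M)                ≤⟨ ℕ.*-monoʳ-≤ (2 * suc i + A) 2M≤ ⟩
  (2 * suc i + A) * (2 * suc i + A * suc a) <⟨ ℕ.*-monoʳ-< (2 * suc i + A) below ⟩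
  (2 * suc i + A) * (A * (3 + l))          ≡⟨ cong (_* (A * (3 + l))) eq ⟨
  (4 + l) * (A * (3 + l))                  ≡⟨ shuffle A l ⟩
  A * ((3 + l) * (4 + l))                  ≡⟨ cong (A *_) (binomial-2 (2 + l)) ⟨
  A * (2 * binomial 2 (2 + l))             ≡⟨ pull A (binomial 2 (2 + l)) ⟨
  2 * (A * binomial 2 (2 + l))             ∎)
  where
  open ℕ.≤-Reasoning
  A = suc (suc a)
  M = majorant (suc i) A 2 (2 + l)
  pull : ∀ u v → 2 * (u * v) ≡ u * (2 * v)
  pull = ℕ-Solver.solve-∀
  shuffle : ∀ A l → (4 + l) * (A * (3 + l)) ≡ A * ((3 + l) * (4 + l))
  shuffle = ℕ-Solver.solve-∀
  split : ∀ i a → 2 * suc i + suc (suc a) * suc (suc a) ≡ 2 * suc i + suc (suc a) * suc a + suc (suc a)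
  split = ℕ-Solver.solve-∀
  2M≤ : 2 * M ≤ 2 * suc i + A * suc a
  2M≤ = ℕ.+-cancelʳ-≤ A _ _ (subst (2 * M + A ≤_) (split i a) (majorant-2 (suc i) A (2 + l)))
  3+l≡ : 3 + l ≡ 2 * suc i + suc a
  3+l≡ = ℕ.suc-injective (trans eq (ℕ.+-suc (2 * suc i) (suc a)))
  excess : ∀ i a → suc (2 * suc i + suc (suc a) * suc a) + (suc (2 * i) + 2 * (suc i * a)) ≡
                   suc (suc a) * (2 * suc i + suc a)
  excess = ℕ-Solver.solve-∀
  below : 2 * suc i + A * suc a < A * (3 + l)
  below = subst (2 * suc i + A * suc a <_) (trans (excess i a) (cong (A *_) (sym 3+l≡))) (ℕ.m≤m+n _ _)

mutual
  -- Induction on the number of factors y² + x². Both indices must be positive: at index 0 majorant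
  -- and binomial are both 1, and 2i + a exceeds a once i > 0. Index 1 is handled by its explicit
  -- coefficient, the remaining indices by the strict version.
  majorant≤binomial : ∀ i a j l → 2 ≤ a → suc j + suc l ≡ 2 * i + a →
    (2 * i + a) * majorant i a (suc j) (suc l) ≤ a * binomial (suc j) (suc l)
  majorant≤binomial zero    a j l 2≤a eq =
    ℕ.≤-reflexive (cong (a *_) (majorant-binomial a (suc j) (suc l) eq))
  majorant≤binomial (suc i) a zero    l       2≤a eq = begin
    (2 * suc i + a) * majorant (suc i) a 1 (suc l)  ≤⟨ ℕ.*-monoʳ-≤ (2 * suc i + a) (majorant-1 (suc i) a (suc l)) ⟩
    (2 * suc i + a) * a                             ≡⟨ cong (_* a) eq ⟨
    suc (suc l) * a                                 ≡⟨ cong (_* a) (binomial-1 (suc l)) ⟨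
    binomial 1 (suc l) * a                          ≡⟨ ℕ.*-comm (binomial 1 (suc l)) a ⟩
    a * binomial 1 (suc l)                          ∎
    where open ℕ.≤-Reasoning
  majorant≤binomial (suc i) a (suc j) zero    2≤a eq = subst₂ (λ u v → (2 * suc i + a) * u ≤ a * v)
    (majorant-comm (suc i) a 1 (suc (suc j))) (binomial-comm 1 (suc (suc j)))
    (majorant≤binomial (suc i) a zero (suc j) 2≤a (trans (ℕ.+-comm 1 (suc (suc j))) eq))
  majorant≤binomial (suc i) a (suc j) (suc l) 2≤a eq = ℕ.<⇒≤ (majorant<binomial i a j l 2≤a eq)

  -- The recursion lowers one index by 2, so with both indices at least 3 it only meets the weak
  -- bound at positive indices; index 2 has to be a base case.
  majorant<binomial : ∀ i a j l → 2 ≤ a → (2 + j) + (2 + l) ≡ 2 * suc i + a →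
    (2 * suc i + a) * majorant (suc i) a (2 + j) (2 + l) < a * binomial (2 + j) (2 + l)
  majorant<binomial i a zero    l       2≤a eq = majorant<binomial-2 i a l 2≤a eq
  majorant<binomial i a (suc j) zero    2≤a eq = subst₂ (λ u v → (2 * suc i + a) * u < a * v)
    (majorant-comm (suc i) a 2 (3 + j)) (binomial-comm 2 (3 + j))
    (majorant<binomial-2 i a (suc j) 2≤a (trans (ℕ.+-comm 2 (3 + j)) eq))
  -- With n = m + 2, the induction hypotheses bound m n (M₁ + M₂) by n a (X₁ + X₂). Two applications
  -- of Pascal's rule give X₁ + X₂ = Z - 2Y for the target binomial Z, so the claim reduces to X₁ +
  -- X₂ < m Y, that is Z < n Y.
  majorant<binomial i a@(suc _) (suc j) (suc l) 2≤a eq = ℕ.*-cancelˡ-< m _ _ (begin-strict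
    m * ((2 * suc i + a) * (M₁ + M₂))               ≡⟨ cong (λ t → m * (t * (M₁ + M₂))) n≡ ⟩
    m * ((2 + m) * (M₁ + M₂))                       ≡⟨ regroup m M₁ M₂ ⟩
    (2 + m) * (m * M₁ + m * M₂)                     ≤⟨ ℕ.*-monoʳ-≤ (2 + m) (ℕ.+-mono-≤ ih₁ ih₂) ⟩
    (2 + m) * (a * X₁ + a * X₂)                     ≡⟨ expand m a X₁ X₂ ⟩
    a * (m * (X₁ + X₂)) + 2 * a * (X₁ + X₂)         <⟨ ℕ.+-monoʳ-< (a * (m * (X₁ + X₂))) (ℕ.*-monoʳ-< (2 * a) X<mY) ⟩
    a * (m * (X₁ + X₂)) + 2 * a * (m * Y)           ≡⟨ collect m a X₁ X₂ Y ⟩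
    m * (a * ((X₂ + Y) + (Y + X₁)))                 ∎)
    where
    open ℕ.≤-Reasoning
    m = 2 * i + a
    M₁ = majorant i a (3 + j) (1 + l)
    M₂ = majorant i a (1 + j) (3 + l)
    X₁ = binomial (3 + j) (1 + l)
    X₂ = binomial (1 + j) (3 + l)
    Y  = binomial (2 + j) (2 + l)
    n≡ : 2 * suc i + a ≡ 2 + m
    n≡ = lem i a
      where
      lem : ∀ i a → 2 * suc i + a ≡ 2 + (2 * i + a)
      lem = ℕ-Solver.solve-∀
    m≡ : m ≡ 4 + (j + l)
    m≡ = ℕ.+-cancelˡ-≡ 2 _ _ (trans (sym n≡) (trans (sym eq) (lem j l)))
      where
      lem : ∀ j l → (3 + j) + (3 + l) ≡ 2 + (4 + (j + l))
      lem = ℕ-Solver.solve-∀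
    ih₁ : m * M₁ ≤ a * X₁
    ih₁ = majorant≤binomial i a (2 + j) l 2≤a (trans (lem j l) (sym m≡))
      where
      lem : ∀ j l → (3 + j) + (1 + l) ≡ 4 + (j + l)
      lem = ℕ-Solver.solve-∀
    ih₂ : m * M₂ ≤ a * X₂
    ih₂ = majorant≤binomial i a j (2 + l) 2≤a (trans (lem j l) (sym m≡))
      where
      lem : ∀ j l → (1 + j) + (3 + l) ≡ 4 + (j + l)
      lem = ℕ-Solver.solve-∀
    regroup : ∀ m u v → m * ((2 + m) * (u + v)) ≡ (2 + m) * (m * u + m * v)
    regroup = ℕ-Solver.solve-∀
    expand : ∀ m a u v → (2 + m) * (a * u + a * v) ≡ a * (m * (u + v)) + 2 * a * (u + v)
    expand = ℕ-Solver.solve-∀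
    collect : ∀ m a u v y → a * (m * (u + v)) + 2 * a * (m * y) ≡ m * (a * ((v + y) + (y + u)))
    collect = ℕ-Solver.solve-∀
    Z = (X₂ + Y) + (Y + X₁)
    -- With n = m + 2, binomial-diagonal reads n (n − 1) Y = (3 + j)(3 + l) Z, and (3 + j)(3 + l) > n − 1.
    diagonal : (2 + (2 + j + (2 + l))) * (1 + (2 + j + (2 + l))) * Y ≡ (3 + j) * (3 + l) * Z
    diagonal = binomial-diagonal (2 + j) (2 + l)
    Z<nY : Z < (6 + (j + l)) * Y
    Z<nY = ℕ.*-cancelˡ-< (5 + (j + l)) _ _ (begin-strict
      (5 + (j + l)) * Z                             <⟨ ℕ.m<m+n _ (ℕ.*-mono-≤ (s≤s (z≤n {3 + j * l + 2 * j + 2 * l})) Z>0) ⟩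
      (5 + (j + l)) * Z + (4 + j * l + 2 * j + 2 * l) * Z ≡⟨ split j l Z ⟩
      (3 + j) * (3 + l) * Z                         ≡⟨ diagonal ⟨
      (2 + (2 + j + (2 + l))) * (1 + (2 + j + (2 + l))) * Y ≡⟨ join j l Y ⟩
      (5 + (j + l)) * ((6 + (j + l)) * Y)           ∎)
      where
      Z>0 : 0 < Z
      Z>0 = binomial>0 (3 + j) (3 + l)
      split : ∀ j l z → (5 + (j + l)) * z + (4 + j * l + 2 * j + 2 * l) * z ≡ (3 + j) * (3 + l) * z
      split = ℕ-Solver.solve-∀
      join : ∀ j l y → (2 + (2 + j + (2 + l))) * (1 + (2 + j + (2 + l))) * y ≡ (5 + (j + l)) * ((6 + (j + l)) * y)
      join = ℕ-Solver.solve-∀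
    X<mY : X₁ + X₂ < m * Y
    X<mY = ℕ.+-cancelˡ-< (2 * Y) _ _ (subst₂ _<_ (left X₁ X₂ Y) (trans (right (j + l) Y) (cong (λ t → 2 * Y + t * Y) (sym m≡))) Z<nY)
      where
      left : ∀ u v y → (v + y) + (y + u) ≡ 2 * y + (u + v)
      left = ℕ-Solver.solve-∀
      right : ∀ s y → (6 + s) * y ≡ 2 * y + (4 + s) * y
      right = ℕ-Solver.solve-∀

-- The least eigenvalue

krawtchouk-0ˡ : ∀ q k l → krawtchouk 0 q k l ≡ + majorant 0 q k l
krawtchouk-0ˡ zero    zero    zero    = refl
krawtchouk-0ˡ zero    zero    (suc l) = refl
krawtchouk-0ˡ zero    (suc k) zero    = refl
krawtchouk-0ˡ zero    (suc k) (suc l) = refl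
krawtchouk-0ˡ (suc q) k       l       =
  cong₂ ℤ._+_ (y-part k l) (trans (ℤ.*-identityˡ (x· 0ℤ (krawtchouk 0 q) k l)) (x-part k l))
  where
  y-part : ∀ k l → y· 0ℤ (krawtchouk 0 q) k l ≡ + y· 0 (majorant 0 q) k l
  y-part k zero    = refl
  y-part k (suc l) = krawtchouk-0ˡ q k l
  x-part : ∀ k l → x· 0ℤ (krawtchouk 0 q) k l ≡ + x· 0 (majorant 0 q) k l
  x-part zero    l = refl
  x-part (suc k) l = krawtchouk-0ˡ q k l

∣∣-≤⇒nonneg : ∀ n i c → n * ℤ.∣ i ∣ ≤ c → 0ℤ ℤ.≤ + n ℤ.* i ℤ.+ + c
∣∣-≤⇒nonneg n (+ m)      c _  = subst (λ t → 0ℤ ℤ.≤ t ℤ.+ + c) (ℤ.pos-* n m) (ℤ.+≤+ z≤n)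
∣∣-≤⇒nonneg n (-[1+ m ]) c le = subst (0ℤ ℤ.≤_)
  (trans (ℤ.+-comm (+ c) (ℤ.- (+ (n * suc m))))
    (cong (ℤ._+ + c) (trans (cong ℤ.-_ (ℤ.pos-* n (suc m))) (ℤ.neg-distribʳ-* (+ n) (+ suc m)))))
  (ℤ.i≤j⇒0≤j-i (ℤ.+≤+ le))

∣∣-<⇒pos : ∀ n i c → n * ℤ.∣ i ∣ < c → 0ℤ ℤ.< + n ℤ.* i ℤ.+ + c
∣∣-<⇒pos n i (suc c) (s≤s le) = subst (0ℤ ℤ.<_) (shift (+ n ℤ.* i) (+ c))
  (ℤ.+-mono-<-≤ (ℤ.+<+ (s≤s z≤n)) (∣∣-≤⇒nonneg n i c le))
  where
  shift : ∀ u c → 1ℤ ℤ.+ (u ℤ.+ c) ≡ u ℤ.+ (1ℤ ℤ.+ c)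
  shift = solve-∀

-- The eigenvalue of H (k + l) k on characters of weight p (and of the complementary weight q),
-- multiplied by k + l and shifted by its claimed least value.

eigengap : ℕ → ℕ → ℕ → ℕ → ℕ → ℤ
eigengap a p q k l = + (k + l) ℤ.* krawtchouk p q k l ℤ.+ + (a * binomial k l)

module _ {a k l : ℕ} (2≤a : 2 ≤ a) (k≡l+a : k ≡ l + a) where

  private
    n≡ : 2 * l + a ≡ k + l
    n≡ = trans (lem l a) (cong (_+ l) (sym k≡l+a))
      where
      lem : ∀ l a → 2 * l + a ≡ (l + a) + l
      lem = ℕ-Solver.solve-∀

    module _ (p q : ℕ) (p+q≡ : p + q ≡ k + l) where

      dual-gap : ℤ
      dual-gap = + (k + l) ℤ.* krawtchouk k l p q ℤ.+ + (a * binomial p q)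

      -- Up to positive binomial factors the gap may be computed with the two types exchanged; there
      -- k and l are the exponents of the linear factors, and k = l + a makes `majorant l a`
      -- applicable.
      gap-duality : + binomial p q ℤ.* eigengap a p q k l ≡ + binomial k l ℤ.* dual-gap
      gap-duality = begin
        + P ℤ.* (+ (k + l) ℤ.* κ ℤ.+ + (a * Q))
          ≡⟨ cong (λ t → + P ℤ.* (+ (k + l) ℤ.* κ ℤ.+ t)) (ℤ.pos-* a Q) ⟩
        + P ℤ.* (+ (k + l) ℤ.* κ ℤ.+ + a ℤ.* + Q)
          ≡⟨ distrib (+ P) (+ Q) (+ (k + l)) κ (+ a) ⟩
        + (k + l) ℤ.* (+ P ℤ.* κ) ℤ.+ + a ℤ.* (+ P ℤ.* + Q)
          ≡⟨ cong (λ t → + (k + l) ℤ.* t ℤ.+ + a ℤ.* (+ P ℤ.* + Q)) (krawtchouk-duality p q k l p+q≡ refl) ⟩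
        + (k + l) ℤ.* (+ Q ℤ.* κ′) ℤ.+ + a ℤ.* (+ P ℤ.* + Q)
          ≡⟨ collect (+ P) (+ Q) (+ (k + l)) κ′ (+ a) ⟩
        + Q ℤ.* (+ (k + l) ℤ.* κ′ ℤ.+ + a ℤ.* + P)
          ≡⟨ cong (λ t → + Q ℤ.* (+ (k + l) ℤ.* κ′ ℤ.+ t)) (ℤ.pos-* a P) ⟨
        + Q ℤ.* dual-gap ∎
        where
        open ≡-Reasoning
        P = binomial p q
        Q = binomial k l
        κ = krawtchouk p q k l
        κ′ = krawtchouk k l p q
        distrib : ∀ P Q n κ a → P ℤ.* (n ℤ.* κ ℤ.+ a ℤ.* Q) ≡ n ℤ.* (P ℤ.* κ) ℤ.+ a ℤ.* (P ℤ.* Q)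
        distrib = solve-∀
        collect : ∀ P Q n κ a → n ℤ.* (Q ℤ.* κ) ℤ.+ a ℤ.* (P ℤ.* Q) ≡ Q ℤ.* (n ℤ.* κ ℤ.+ a ℤ.* P)
        collect = solve-∀

      scaled-bound : (k + l) * ℤ.∣ krawtchouk k l p q ∣ ≤ (2 * l + a) * majorant l a p q
      scaled-bound = subst₂ (λ t k → t * ℤ.∣ krawtchouk k l p q ∣ ≤ (2 * l + a) * majorant l a p q) n≡ (sym k≡l+a)
        (ℕ.*-monoʳ-≤ (2 * l + a) (∣krawtchouk∣≤majorant l a p q))

      gap≥0 : 0ℤ ℤ.≤ dual-gap → 0ℤ ℤ.≤ eigengap a p q k l
      gap≥0 d≥0 = cancel (binomial p q) (binomial k l) (binomial>0 p q) gap-duality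
        where
        cancel : ∀ P Q {d} → 0 < P → + P ℤ.* d ≡ + Q ℤ.* dual-gap → 0ℤ ℤ.≤ d
        cancel (suc P) Q {d} _ eq = ℤ.*-cancelˡ-≤-pos 0ℤ d (+ suc P)
          (subst₂ ℤ._≤_ (trans (ℤ.*-zeroʳ (+ Q)) (sym (ℤ.*-zeroʳ (+ suc P)))) (sym eq)
            (ℤ.*-monoˡ-≤-nonNeg (+ Q) d≥0))

      gap>0 : 0ℤ ℤ.< dual-gap → 0ℤ ℤ.< eigengap a p q k l
      gap>0 d>0 = cancel (binomial p q) (binomial k l) (binomial>0 k l) gap-duality
        where
        cancel : ∀ P Q {d} → 0 < Q → + P ℤ.* d ≡ + Q ℤ.* dual-gap → 0ℤ ℤ.< d
        cancel P (suc Q) {d} _ eq = ℤ.*-cancelˡ-<-nonNeg (+ P)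
          (subst₂ ℤ._<_ (trans (ℤ.*-zeroʳ (+ suc Q)) (sym (ℤ.*-zeroʳ (+ P)))) (sym eq)
            (ℤ.*-monoˡ-<-pos (+ suc Q) d>0))

  -- The majorant bound fails at index 0, so the trivial character is treated directly: its
  -- eigenvalue is nonnegative, and the shift is already positive.
  eigengap-0 : ∀ q → 0ℤ ℤ.< eigengap a 0 q k l
  eigengap-0 q = subst (λ t → 0ℤ ℤ.< + (k + l) ℤ.* t ℤ.+ + (a * binomial k l)) (sym (krawtchouk-0ˡ q k l))
    (subst (λ t → 0ℤ ℤ.< t ℤ.+ + (a * binomial k l)) (ℤ.pos-* (k + l) (majorant 0 q k l))
      (ℤ.+-mono-≤-< (ℤ.+≤+ z≤n) (ℤ.+<+ (ℕ.*-mono-≤ (ℕ.<⇒≤ 2≤a) (binomial>0 k l)))))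

  eigengap-nonneg : ∀ p q → suc p + suc q ≡ k + l → 0ℤ ℤ.≤ eigengap a (suc p) (suc q) k l
  eigengap-nonneg p q eq = gap≥0 (suc p) (suc q) eq (∣∣-≤⇒nonneg (k + l) (krawtchouk k l (suc p) (suc q)) _
    (ℕ.≤-trans (scaled-bound (suc p) (suc q) eq) (majorant≤binomial l a p q 2≤a (trans eq (sym n≡)))))

  -- Both indices at least 2 exclude the weights 1 and n - 1, which belong to the coordinate
  -- characters and their complements. Strictness uses one quadratic factor, hence `0 < l`.
  eigengap-pos : ∀ p q → 0 < l → (2 + p) + (2 + q) ≡ k + l → 0ℤ ℤ.< eigengap a (2 + p) (2 + q) k l
  eigengap-pos p q 0<l eq = gap>0 (2 + p) (2 + q) eq (∣∣-<⇒pos (k + l) (krawtchouk k l (2 + p) (2 + q)) _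
    (ℕ.≤-<-trans (scaled-bound (2 + p) (2 + q) eq) (strict l 0<l (trans eq (sym n≡)))))
    where
    strict : ∀ l → 0 < l → (2 + p) + (2 + q) ≡ 2 * l + a →
             (2 * l + a) * majorant l a (2 + p) (2 + q) < a * binomial (2 + p) (2 + q)
    strict (suc i) _ eq′ = majorant<binomial i a p q 2≤a eq′

-- Even-weight vectors

parity : ∀ {m} → Vec Bool m → Bool
parity []      = false
parity (b ∷ x) = b xor parity x

parity-⊕ : ∀ {m} (x y : Vec Bool m) → parity (x ⊕ y) ≡ parity x xor parity y
parity-⊕ []          []          = refl
parity-⊕ (false ∷ x) (false ∷ y) = parity-⊕ x y
parity-⊕ (false ∷ x) (true  ∷ y) = trans (cong not (parity-⊕ x y)) (lem (parity x) (parity y))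
  where
  lem : ∀ a b → not (a xor b) ≡ a xor not b
  lem false b = refl
  lem true  b = refl
parity-⊕ (true  ∷ x) (false ∷ y) = trans (cong not (parity-⊕ x y)) (lem (parity x) (parity y))
  where
  lem : ∀ a b → not (a xor b) ≡ not a xor b
  lem false b     = refl
  lem true  false = refl
  lem true  true  = refl
parity-⊕ (true  ∷ x) (true  ∷ y) = trans (parity-⊕ x y) (lem (parity x) (parity y))
  where
  lem : ∀ a b → a xor b ≡ not a xor not b
  lem false false = refl
  lem false true  = refl
  lem true  false = refl
  lem true  true  = refl

-- complete identifies ℤ₂ᵐ with the even-weight vectors of length m + 1. A character of the latter is
-- given by a subset up to complement; χ S stands for the one that omits the first coordinate.

complete : ∀ {m} → Vec Bool m → Vec Bool (suc m)
complete y = parity y ∷ y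

complete-⊕ : ∀ {m} (y : Vec Bool m) B → parity B ≡ false → complete (y ⊕ tail B) ≡ complete y ⊕ B
complete-⊕ y (b ∷ B) even = cong (_∷ y ⊕ B) (trans (parity-⊕ y B) (cong (parity y xor_) (lem b even)))
  where
  lem : ∀ b → b xor parity B ≡ false → parity B ≡ b
  lem false eq = eq
  lem true  eq with parity B
  lem true  () | false
  lem true  eq | true  = refl

-- Linear combinations of the coordinate characters

linear : ∀ {m} → Vec ℤ m → Vec Bool m → ℤ
linear []      []      = 0ℤ
linear (α ∷ αs) (b ∷ x) = α ℤ.* sgn b ℤ.+ linear αs x

linear-0 : ∀ {m} (x : Vec Bool m) → linear (replicate m 0ℤ) x ≡ 0ℤ
linear-0 []      = refl
linear-0 (b ∷ x) = trans (ℤ.+-identityˡ _) (linear-0 x)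

linear-+ : ∀ {m} (α β : Vec ℤ m) x → linear (zipWith ℤ._+_ α β) x ≡ linear α x ℤ.+ linear β x
linear-+ []      []      []      = refl
linear-+ (a ∷ α) (b ∷ β) (c ∷ x) = trans (cong₂ ℤ._+_ (ℤ.*-distribʳ-+ (sgn c) a b) (linear-+ α β x))
  (interchange (a ℤ.* sgn c) (b ℤ.* sgn c) (linear α x) (linear β x))

linear-* : ∀ {m} c (α : Vec ℤ m) x → linear (Vec.map (ℤ._*_ c) α) x ≡ c ℤ.* linear α x
linear-* c []      []      = sym (ℤ.*-zeroʳ c)
linear-* c (a ∷ α) (b ∷ x) = trans (cong₂ ℤ._+_ (ℤ.*-assoc c a (sgn b)) (linear-* c α x))
  (sym (ℤ.*-distribˡ-+ c (a ℤ.* sgn b) (linear α x)))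

linear-⊕ : ∀ {m} (α : Vec ℤ m) x B → linear α (x ⊕ B) ≡ linear (zipWith (λ a b → a ℤ.* sgn b) α x) B
linear-⊕ []      []      []      = refl
linear-⊕ (a ∷ α) (b ∷ x) (c ∷ B) = cong₂ ℤ._+_
  (trans (cong (ℤ._*_ a) (sgn-xor b c)) (sym (ℤ.*-assoc a (sgn b) (sgn c)))) (linear-⊕ α x B)

IsLinear : ∀ {m} → (Vec Bool m → ℤ) → Set
IsLinear {m} h = Σ[ α ∈ Vec ℤ (suc m) ] (∀ z → h z ≡ linear α (complete z))

IsLinear-*ˡ : ∀ {m} c {h : Vec Bool m → ℤ} → IsLinear h → IsLinear (λ z → c ℤ.* h z)
IsLinear-*ˡ c (α , h≗) = Vec.map (ℤ._*_ c) α , λ z → trans (cong (ℤ._*_ c) (h≗ z)) (sym (linear-* c α (complete z)))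

IsLinear-∑ : ∀ {m} {A : Set} (xs : List A) {h : A → Vec Bool m → ℤ} →
             (∀ x → IsLinear (h x)) → IsLinear (λ z → ∑ xs (λ x → h x z))
IsLinear-∑ {m} []       lin = replicate (suc m) 0ℤ , λ z → sym (linear-0 (complete z))
IsLinear-∑     (x ∷ xs) lin with lin x | IsLinear-∑ xs lin
... | α , h≗ | β , ∑≗ = zipWith ℤ._+_ α β ,
  λ z → trans (cong₂ ℤ._+_ (h≗ z) (∑≗ z)) (sym (linear-+ α β (complete z)))

weight≡0⇒𝟎 : ∀ {m} (S : Vec Bool m) → weight S ≡ 0 → S ≡ 𝟎
weight≡0⇒𝟎 []          _  = refl
weight≡0⇒𝟎 (false ∷ S) eq = cong (false ∷_) (weight≡0⇒𝟎 S eq)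

χ-weight-1 : ∀ {m} (S : Vec Bool m) → weight S ≡ 1 → Σ[ α ∈ Vec ℤ m ] (∀ z → χ S z ≡ linear α z)
χ-weight-1 (false ∷ S) eq with χ-weight-1 S eq
... | α , χ≗ = 0ℤ ∷ α , λ { (b ∷ z) → trans (ℤ.*-identityˡ _) (trans (χ≗ z) (sym (ℤ.+-identityˡ _))) }
χ-weight-1 {suc m} (true ∷ S) eq = 1ℤ ∷ replicate m 0ℤ ,
  λ { (b ∷ z) → trans (trans (cong (λ T → sgn b ℤ.* χ T z) (weight≡0⇒𝟎 S (ℕ.suc-injective eq)))
        (trans (cong (ℤ._*_ (sgn b)) (χ-𝟎 z)) (ℤ.*-comm (sgn b) 1ℤ)))
      (sym (trans (cong (ℤ._+_ (1ℤ ℤ.* sgn b)) (linear-0 z)) (ℤ.+-identityʳ _))) }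

χ-zeros-0 : ∀ {m} (S : Vec Bool m) → zeros S ≡ 0 → ∀ z → χ S z ≡ sgn (parity z)
χ-zeros-0 []         _  []      = refl
χ-zeros-0 (true ∷ S) eq (b ∷ z) = trans (cong (ℤ._*_ (sgn b)) (χ-zeros-0 S eq z)) (sym (sgn-xor b (parity z)))

χ-linear-1 : ∀ {m} (S : Vec Bool m) → weight S ≡ 1 → IsLinear (χ S)
χ-linear-1 S eq with χ-weight-1 S eq
... | α , χ≗ = 0ℤ ∷ α , λ z → trans (χ≗ z) (sym (ℤ.+-identityˡ _))

-- The set of all retained coordinates is complementary to the dropped one, so its character is the
-- coordinate character of the first entry `parity z` of `complete z`.
χ-linear-0 : ∀ {m} (S : Vec Bool m) → zeros S ≡ 0 → IsLinear (χ S)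
χ-linear-0 {m} S eq = 1ℤ ∷ replicate m 0ℤ , λ z → trans (χ-zeros-0 S eq z)
  (sym (trans (cong₂ ℤ._+_ (ℤ.*-identityˡ (sgn (parity z))) (linear-0 z)) (ℤ.+-identityʳ _)))

∃-weight : ∀ {m j} → j ≤ m → ∃[ A ] weight {m} A ≡ j
∃-weight {zero}  z≤n     = [] , refl
∃-weight {suc m} z≤n     with ∃-weight {m} z≤n
... | A , eq = false ∷ A , eq
∃-weight {suc m} (s≤s j≤m) with ∃-weight j≤m
... | A , eq = true ∷ A , cong suc eq

-- The exchange argument in inductive form: fixing the first coordinate leaves a combination `β` of
-- the others that is constant on the layers of weights k and k + 1 of the smaller cube, and one of
-- these two is proper unless a single coordinate remains.
linear-balanced : ∀ {m} (α : Vec ℤ m) k c → 0 < k → k < m → (∀ A → weight A ≡ k → linear α A ≡ c) →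
                  ∃[ w ] (∀ B → linear α B ≡ w ℤ.* (+ m ℤ.- + 2 ℤ.* + weight B))
linear-balanced {suc zero}    α       (suc k) c 0<k (s≤s ()) const
linear-balanced {suc (suc m)} (b ∷ β) (suc k) c 0<k (s≤s k≤m) const = w , λ { (e ∷ B) → extend e B }
  where
  open ≡-Reasoning
  const-false : ∀ A → weight A ≡ suc k → linear β A ≡ c ℤ.- b
  const-false A eq = trans (lem b (linear β A)) (cong (ℤ._- b) (const (false ∷ A) eq))
    where
    lem : ∀ b u → u ≡ (b ℤ.* 1ℤ ℤ.+ u) ℤ.- b
    lem = solve-∀
  const-true : ∀ A → weight A ≡ k → linear β A ≡ c ℤ.+ b
  const-true A eq = trans (lem b (linear β A)) (cong (ℤ._+ b) (const (true ∷ A) (cong suc eq)))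
    where
    lem : ∀ b u → u ≡ (b ℤ.* -1ℤ ℤ.+ u) ℤ.+ b
    lem = solve-∀
  rest : ∀ {m} (β : Vec ℤ (suc m)) → suc k ≤ suc m →
         (∀ A → weight A ≡ suc k → linear β A ≡ c ℤ.- b) → (∀ A → weight A ≡ k → linear β A ≡ c ℤ.+ b) →
         ∃[ w ] (∀ B → linear β B ≡ w ℤ.* (+ suc m ℤ.- + 2 ℤ.* + weight B))
  rest {zero}  (b′ ∷ []) _ _ _ = b′ , λ { (false ∷ []) → lem₁ b′ ; (true ∷ []) → lem₂ b′ }
    where
    lem₁ : ∀ b → b ℤ.* 1ℤ ℤ.+ 0ℤ ≡ b ℤ.* (1ℤ ℤ.- + 2 ℤ.* 0ℤ)
    lem₁ = solve-∀
    lem₂ : ∀ b → b ℤ.* -1ℤ ℤ.+ 0ℤ ≡ b ℤ.* (1ℤ ℤ.- + 2 ℤ.* 1ℤ)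
    lem₂ = solve-∀
  -- If the layer of weight k + 1 is not proper in the remaining cube, then k is positive and the
  -- layer of weight k is proper.
  rest {suc m} β k≤m cf ct with k ℕ.<? suc m
  ... | yes k<m = linear-balanced β (suc k) (c ℤ.- b) (s≤s z≤n) (s≤s k<m) cf
  ... | no  k≮m = linear-balanced β k (c ℤ.+ b) (ℕ.<-≤-trans (s≤s z≤n) (ℕ.≮⇒≥ k≮m)) k≤m ct
  ih = rest β k≤m const-false const-true
  w : ℤ
  w = proj₁ ih
  b≡w : b ≡ w
  -- Neither layer is empty. The two constants differ by 2b, while by the induction hypothesis one
  -- more true entry costs 2w.
  b≡w with ∃-weight {suc m} {k} (ℕ.<⇒≤ k≤m) | ∃-weight {suc m} {suc k} k≤m
  ... | A , eqA | A′ , eqA′ = ℤ.*-cancelˡ-≡ (+ 2) b w (begin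
    + 2 ℤ.* b                          ≡⟨ lem₁ b c ⟩
    (c ℤ.+ b) ℤ.- (c ℤ.- b)            ≡⟨ cong₂ ℤ._-_ (const-true A eqA) (const-false A′ eqA′) ⟨
    linear β A ℤ.- linear β A′         ≡⟨ cong₂ ℤ._-_ (at A eqA) (at A′ eqA′) ⟩
    w ℤ.* (+ suc m ℤ.- + 2 ℤ.* + k) ℤ.- w ℤ.* (+ suc m ℤ.- + 2 ℤ.* (1ℤ ℤ.+ + k)) ≡⟨ lem₂ w (+ suc m) (+ k) ⟩
    + 2 ℤ.* w                          ∎)
    where
    at : ∀ A {j} → weight A ≡ j → linear β A ≡ w ℤ.* (+ suc m ℤ.- + 2 ℤ.* + j)
    at A refl = proj₂ ih A
    lem₁ : ∀ b c → + 2 ℤ.* b ≡ (c ℤ.+ b) ℤ.- (c ℤ.- b)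
    lem₁ = solve-∀
    lem₂ : ∀ w m k → w ℤ.* (m ℤ.- + 2 ℤ.* k) ℤ.- w ℤ.* (m ℤ.- + 2 ℤ.* (1ℤ ℤ.+ k)) ≡ + 2 ℤ.* w
    lem₂ = solve-∀
  extend : ∀ e B → b ℤ.* sgn e ℤ.+ linear β B ≡ w ℤ.* (+ suc (suc m) ℤ.- + 2 ℤ.* + weight (e ∷ B))
  extend e B = trans (cong₂ (λ u v → u ℤ.* sgn e ℤ.+ v) b≡w (proj₂ ih B)) (lem e)
    where
    plus : ∀ w m k → w ℤ.* 1ℤ ℤ.+ w ℤ.* (m ℤ.- + 2 ℤ.* k) ≡ w ℤ.* ((1ℤ ℤ.+ m) ℤ.- + 2 ℤ.* k)
    plus = solve-∀
    minus : ∀ w m k → w ℤ.* -1ℤ ℤ.+ w ℤ.* (m ℤ.- + 2 ℤ.* k) ≡ w ℤ.* ((1ℤ ℤ.+ m) ℤ.- + 2 ℤ.* (1ℤ ℤ.+ k))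
    minus = solve-∀
    lem : ∀ e → w ℤ.* sgn e ℤ.+ w ℤ.* (+ suc m ℤ.- + 2 ℤ.* + weight B) ≡
                w ℤ.* (+ suc (suc m) ℤ.- + 2 ℤ.* + weight (e ∷ B))
    lem false = plus w (+ suc m) (+ weight B)
    lem true  = minus w (+ suc m) (+ weight B)

-- The equality case of the eigenvalue bound

∑-allFin : ∀ m (f : Fin (suc m) → ℤ) → ∑ (allFin (suc m)) f ≡ f zero ℤ.+ ∑ (allFin m) (f ∘ suc)
∑-allFin m f = cong (ℤ._+_ (f zero))
  (trans (cong (λ xs → ∑ xs f) (sym (map-tabulate id suc))) (∑-map suc (allFin m) f))

gram : ∀ {m} → Vec Bool m → Vec Bool m → ℤ
gram {m} u v = ∑ (allFin m) (λ c → sgn (lookup u c) ℤ.* sgn (lookup v c))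

gram-hamming : ∀ {m} (u v : Vec Bool m) → gram u v ≡ + m ℤ.- + 2 ℤ.* + hamming u v
gram-hamming {zero}  []      []      = refl
gram-hamming {suc m} (a ∷ u) (b ∷ v) = trans (∑-allFin m (λ c → sgn (lookup (a ∷ u) c) ℤ.* sgn (lookup (b ∷ v) c)))
  (trans (cong (ℤ._+_ (sgn a ℤ.* sgn b)) (gram-hamming u v)) (lem a b))
  where
  agree : ∀ m d → 1ℤ ℤ.+ (m ℤ.- + 2 ℤ.* d) ≡ (1ℤ ℤ.+ m) ℤ.- + 2 ℤ.* d
  agree = solve-∀
  differ : ∀ m d → -1ℤ ℤ.+ (m ℤ.- + 2 ℤ.* d) ≡ (1ℤ ℤ.+ m) ℤ.- + 2 ℤ.* (1ℤ ℤ.+ d)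
  differ = solve-∀
  lem : ∀ a b → sgn a ℤ.* sgn b ℤ.+ (+ m ℤ.- + 2 ℤ.* + hamming u v) ≡
                + suc m ℤ.- + 2 ℤ.* + hamming (a ∷ u) (b ∷ v)
  lem false false = agree (+ m) (+ hamming u v)
  lem false true  = differ (+ m) (+ hamming u v)
  lem true  false = differ (+ m) (+ hamming u v)
  lem true  true  = agree (+ m) (+ hamming u v)

gram-self : ∀ {m} (u : Vec Bool m) → gram u u ≡ + m
gram-self {m} u = trans (gram-hamming u u)
  (trans (cong (λ d → + m ℤ.- + 2 ℤ.* + d) (hamming-refl u)) (ℤ.+-identityʳ (+ m)))

parity-𝟎 : ∀ m → parity (𝟎 {m}) ≡ false
parity-𝟎 zero    = refl
parity-𝟎 (suc m) = parity-𝟎 m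

weight-𝟎 : ∀ m → weight (𝟎 {m}) ≡ 0
weight-𝟎 zero    = refl
weight-𝟎 (suc m) = weight-𝟎 m

cancel-nonzero : ∀ i j → i ℤ.* j ≡ 0ℤ → i ≢ 0ℤ → j ≡ 0ℤ
cancel-nonzero i j eq i≢0 with ℤ.i*j≡0⇒i≡0∨j≡0 i eq
... | inj₁ i≡0 = ⊥-elim (i≢0 i≡0)
... | inj₂ j≡0 = j≡0

square-factor : ∀ i g → i ℤ.* i ℤ.* g ≡ 0ℤ → 0ℤ ℤ.< g → i ≡ 0ℤ
square-factor i g eq g>0 with ℤ.i*j≡0⇒i≡0∨j≡0 (i ℤ.* i) eq
... | inj₂ g≡0 = ⊥-elim (ℤ.<-irrefl (sym g≡0) g>0)
... | inj₁ i²≡0 with ℤ.i*j≡0⇒i≡0∨j≡0 i i²≡0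
...   | inj₁ i≡0 = i≡0
...   | inj₂ i≡0 = i≡0

2^≢0 : ∀ m → 2^ m ≢ 0ℤ
2^≢0 m eq = ℕ.<-irrefl (sym (ℤ.+-injective eq)) (ℕ.m^n>0 2 m)

module _ {N : ℕ} (k l : ℕ) (k+l≡ : k + l ≡ suc N) (a : ℕ) where

  private
    n = k + l

  -- S omits the first coordinate, so among all n coordinates it is `false ∷ S`; hence the `suc` on
  -- its zeros.
  ∑-layer-eigengap : ∀ (S : Vec Bool N) →
    ∑ (layer (suc N) k l) (λ A → + n ℤ.* χ S (tail A) ℤ.+ + a) ≡ eigengap a (weight S) (suc (zeros S)) k l
  ∑-layer-eigengap S = begin
    ∑ Λ (λ A → + n ℤ.* χ S (tail A) ℤ.+ + a)
      ≡⟨ ∑-+ Λ _ _ ⟩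
    ∑ Λ (λ A → + n ℤ.* χ S (tail A)) ℤ.+ ∑ Λ (λ _ → + a)
      ≡⟨ cong₂ ℤ._+_ (∑-*ˡ Λ (+ n) (λ A → χ S (tail A))) (∑-const Λ (+ a)) ⟩
    + n ℤ.* ∑ Λ (λ A → χ S (tail A)) ℤ.+ + length Λ ℤ.* + a
      ≡⟨ cong₂ (λ u v → + n ℤ.* u ℤ.+ v) (trans (∑-cong Λ drop-head) (∑-layer-χ (false ∷ S) k l)) count ⟩
    eigengap a (weight S) (suc (zeros S)) k l ∎
    where
    open ≡-Reasoning
    Λ = layer (suc N) k l
    drop-head : ∀ A → χ S (tail A) ≡ χ (false ∷ S) A
    drop-head (b ∷ A) = sym (ℤ.*-identityˡ (χ S A))
    count : + length Λ ℤ.* + a ≡ + (a * binomial k l)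
    count = trans (cong (λ t → + t ℤ.* + a) (length-layer-binomial k l k+l≡))
      (trans (ℤ.*-comm (+ binomial k l) (+ a)) (sym (ℤ.pos-* a (binomial k l))))

  energy : (Vec Bool N → ℤ) → Vec Bool N → Vec Bool (suc N) → ℤ
  energy f y A = + n ℤ.* (f y ℤ.* f (y ⊕ tail A)) ℤ.+ + a ℤ.* (f y ℤ.* f y)

  -- The quadratic form of n times the adjacency operator plus a times the degree, evaluated at f
  -- and diagonalised by the characters.
  energy-spectrum : ∀ f →
    ∑ (cube N) (λ S → walsh f S ℤ.* walsh f S ℤ.* eigengap a (weight S) (suc (zeros S)) k l) ≡
    2^ N ℤ.* ∑ (layer (suc N) k l) (λ A → ∑ (cube N) (λ y → energy f y A))
  energy-spectrum f = begin
    ∑ (cube N) (λ S → ŵ S ℤ.* eigengap a (weight S) (suc (zeros S)) k l)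
      ≡⟨ ∑-cong (cube N) (λ S → trans (cong (ℤ._*_ (ŵ S)) (sym (∑-layer-eigengap S))) (sym (∑-*ˡ Λ (ŵ S) (t S)))) ⟩
    ∑ (cube N) (λ S → ∑ Λ (λ A → ŵ S ℤ.* t S A))
      ≡⟨ ∑-swap (cube N) Λ _ ⟩
    ∑ Λ (λ A → ∑ (cube N) (λ S → ŵ S ℤ.* t S A))
      ≡⟨ ∑-cong Λ at ⟩
    ∑ Λ (λ A → 2^ N ℤ.* ∑ (cube N) (λ y → energy f y A))
      ≡⟨ ∑-*ˡ Λ (2^ N) _ ⟩
    2^ N ℤ.* ∑ Λ (λ A → ∑ (cube N) (λ y → energy f y A)) ∎
    where
    open ≡-Reasoning
    Λ = layer (suc N) k l
    ŵ : Vec Bool N → ℤ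
    ŵ S = walsh f S ℤ.* walsh f S
    t : Vec Bool N → Vec Bool (suc N) → ℤ
    t S A = + n ℤ.* χ S (tail A) ℤ.+ + a
    expand : ∀ w n x a → w ℤ.* (n ℤ.* x ℤ.+ a) ≡ n ℤ.* (w ℤ.* x) ℤ.+ a ℤ.* (w ℤ.* 1ℤ)
    expand = solve-∀
    factor : ∀ n p u a v → n ℤ.* (p ℤ.* u) ℤ.+ a ℤ.* (p ℤ.* v) ≡ p ℤ.* (n ℤ.* u ℤ.+ a ℤ.* v)
    factor = solve-∀
    at : ∀ A → ∑ (cube N) (λ S → ŵ S ℤ.* t S A) ≡ 2^ N ℤ.* ∑ (cube N) (λ y → energy f y A)
    at A = begin
      ∑ (cube N) (λ S → ŵ S ℤ.* t S A)
        -- The constant 1 is rewritten as `χ S 𝟎`, so that the degree term is the correlation at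
        -- `𝟎`.
        ≡⟨ ∑-cong (cube N) (λ S → trans (expand (ŵ S) (+ n) (χ S (tail A)) (+ a))
             (cong (λ u → + n ℤ.* (ŵ S ℤ.* χ S (tail A)) ℤ.+ + a ℤ.* (ŵ S ℤ.* u))
               (sym (trans (χ-comm S 𝟎) (χ-𝟎 S))))) ⟩
      ∑ (cube N) (λ S → + n ℤ.* (ŵ S ℤ.* χ S (tail A)) ℤ.+ + a ℤ.* (ŵ S ℤ.* χ S 𝟎))
        ≡⟨ ∑-+ (cube N) _ _ ⟩
      ∑ (cube N) (λ S → + n ℤ.* (ŵ S ℤ.* χ S (tail A))) ℤ.+ ∑ (cube N) (λ S → + a ℤ.* (ŵ S ℤ.* χ S 𝟎))
        ≡⟨ cong₂ ℤ._+_ (trans (∑-*ˡ (cube N) (+ n) _) (cong (ℤ._*_ (+ n)) (walsh-correlation f (tail A))))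
                       (trans (∑-*ˡ (cube N) (+ a) _) (cong (ℤ._*_ (+ a)) (walsh-correlation f 𝟎))) ⟩
      + n ℤ.* (2^ N ℤ.* ∑ (cube N) (λ y → f y ℤ.* f (y ⊕ tail A))) ℤ.+
      + a ℤ.* (2^ N ℤ.* ∑ (cube N) (λ y → f y ℤ.* f (y ⊕ 𝟎)))
        ≡⟨ factor (+ n) (2^ N) (∑ (cube N) (λ y → f y ℤ.* f (y ⊕ tail A))) (+ a) _ ⟩
      2^ N ℤ.* (+ n ℤ.* ∑ (cube N) (λ y → f y ℤ.* f (y ⊕ tail A)) ℤ.+
                + a ℤ.* ∑ (cube N) (λ y → f y ℤ.* f (y ⊕ 𝟎)))
        ≡⟨ cong (ℤ._*_ (2^ N)) (sym (trans (∑-+ (cube N) _ _)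
             (cong₂ ℤ._+_ (∑-*ˡ (cube N) (+ n) _)
               (trans (∑-*ˡ (cube N) (+ a) _) (cong (ℤ._*_ (+ a))
                 (∑-cong (cube N) (λ y → cong (λ z → f y ℤ.* f z) (sym (⊕-identityʳ y))))))))) ⟩
      2^ N ℤ.* ∑ (cube N) (λ y → energy f y A) ∎

-- From a lower bound on edges to exact scaling of distances

module Isometry {N n′ k k′ l a : ℕ} (2≤a : 2 ≤ a) (0<l : 0 < l) (k≡l+a : k ≡ l + a) (k+l≡ : k + l ≡ suc N)
  (k-even : ∀ (A : Vec Bool (suc N)) → weight A ≡ k → parity A ≡ false)
  (ratio : k * n′ ≡ k′ * (k + l))
  (ψ : Vec Bool N → Vec Bool n′)
  (far : ∀ y A → weight A ≡ k → k′ ≤ hamming (ψ y) (ψ (y ⊕ tail A)))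
  where

  private
    n = k + l
    Λ = layer (suc N) k l

  f : Fin n′ → Vec Bool N → ℤ
  f c y = sgn (lookup (ψ y) c)

  loss : Vec Bool N → Vec Bool (suc N) → ℤ
  loss y A = -1ℤ ℤ.* (+ n ℤ.* gram (ψ y) (ψ (y ⊕ tail A)) ℤ.+ + a ℤ.* gram (ψ y) (ψ y))

  -- Since n + a = 2k, the Gram terms combine to 2(k n′ - n d), and the ratio hypothesis turns k n′
  -- into k′ n. The loss thus measures by how much an edge is stretched beyond k′.
  loss≡ : ∀ y A → loss y A ≡ + (2 * n) ℤ.* (+ hamming (ψ y) (ψ (y ⊕ tail A)) ℤ.- + k′)
  loss≡ y A = begin
    loss y A
      ≡⟨ cong₂ (λ u v → -1ℤ ℤ.* (+ n ℤ.* u ℤ.+ + a ℤ.* v)) (gram-hamming (ψ y) (ψ (y ⊕ tail A))) (gram-self (ψ y)) ⟩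
    -1ℤ ℤ.* (+ n ℤ.* (+ n′ ℤ.- + 2 ℤ.* + D) ℤ.+ + a ℤ.* + n′)
      ≡⟨ expand (+ k) (+ l) (+ a) (+ n′) (+ D) (cong +_ k≡l+a) ⟩
    + 2 ℤ.* (+ n ℤ.* + D ℤ.- + k ℤ.* + n′)
      ≡⟨ cong (λ t → + 2 ℤ.* (+ n ℤ.* + D ℤ.- t)) ratioℤ ⟩
    + 2 ℤ.* (+ n ℤ.* + D ℤ.- + k′ ℤ.* + n)
      ≡⟨ factor (+ n) (+ D) (+ k′) ⟩
    + 2 ℤ.* + n ℤ.* (+ D ℤ.- + k′)
      ≡⟨ cong (ℤ._* (+ D ℤ.- + k′)) (ℤ.pos-* 2 n) ⟨
    + (2 * n) ℤ.* (+ D ℤ.- + k′) ∎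
    where
    open ≡-Reasoning
    D = hamming (ψ y) (ψ (y ⊕ tail A))
    ratioℤ : + k ℤ.* + n′ ≡ + k′ ℤ.* + n
    ratioℤ = trans (sym (ℤ.pos-* k n′)) (trans (cong +_ ratio) (ℤ.pos-* k′ n))
    expand : ∀ k l a n′ d → k ≡ l ℤ.+ a → -1ℤ ℤ.* ((k ℤ.+ l) ℤ.* (n′ ℤ.- + 2 ℤ.* d) ℤ.+ a ℤ.* n′) ≡
                                          + 2 ℤ.* ((k ℤ.+ l) ℤ.* d ℤ.- k ℤ.* n′)
    expand _ l a n′ d refl = lem l a n′ d
      where
      lem : ∀ l a n′ d → -1ℤ ℤ.* (((l ℤ.+ a) ℤ.+ l) ℤ.* (n′ ℤ.- + 2 ℤ.* d) ℤ.+ a ℤ.* n′) ≡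
                         + 2 ℤ.* (((l ℤ.+ a) ℤ.+ l) ℤ.* d ℤ.- (l ℤ.+ a) ℤ.* n′)
      lem = solve-∀
    factor : ∀ n d k′ → + 2 ℤ.* (n ℤ.* d ℤ.- k′ ℤ.* n) ≡ + 2 ℤ.* n ℤ.* (d ℤ.- k′)
    factor = solve-∀

  loss≥0 : ∀ y {A} → A ∈ Λ → 0ℤ ℤ.≤ loss y A
  loss≥0 y {A} A∈ = subst (0ℤ ℤ.≤_) (sym (loss≡ y A))
    (subst (ℤ._≤ + (2 * n) ℤ.* (+ hamming (ψ y) (ψ (y ⊕ tail A)) ℤ.- + k′)) (ℤ.*-zeroʳ (+ (2 * n)))
      (ℤ.*-monoˡ-≤-nonNeg (+ (2 * n)) (ℤ.i≤j⇒0≤j-i (ℤ.+≤+ (far y A (proj₁ (∈-layer⁻ k l A∈)))))))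

  gap : Vec Bool N → ℤ
  gap S = eigengap a (weight S) (suc (zeros S)) k l

  type≡ : ∀ (S : Vec Bool N) → weight S + suc (zeros S) ≡ n
  type≡ S = trans (ℕ.+-suc (weight S) (zeros S)) (trans (cong suc (weight+zeros S)) (sym k+l≡))

  gap≥0 : ∀ S → 0ℤ ℤ.≤ gap S
  gap≥0 S with weight S | zeros S | type≡ S
  ... | zero  | q | _  = ℤ.<⇒≤ (eigengap-0 2≤a k≡l+a (suc q))
  ... | suc p | q | eq = eigengap-nonneg 2≤a k≡l+a p q eq

  power : Fin n′ → Vec Bool N → ℤ
  power c S = walsh (f c) S ℤ.* walsh (f c) S ℤ.* gap S

  power≥0 : ∀ c S → 0ℤ ℤ.≤ power c S
  power≥0 c S = subst (ℤ._≤ power c S) (ℤ.*-zeroʳ (w ℤ.* w)) (mono w (gap≥0 S))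
    where
    w = walsh (f c) S
    mono : ∀ w {g} → 0ℤ ℤ.≤ g → w ℤ.* w ℤ.* 0ℤ ℤ.≤ w ℤ.* w ℤ.* g
    mono (+ m)      = ℤ.*-monoˡ-≤-nonNeg (+ m ℤ.* + m) {{ℤ.nonNegative (subst (0ℤ ℤ.≤_) (ℤ.pos-* m m) (ℤ.+≤+ z≤n))}}
    mono (-[1+ m ]) = ℤ.*-monoˡ-≤-nonNeg (-[1+ m ] ℤ.* -[1+ m ])

  total-power total-loss : ℤ
  total-power = ∑ (allFin n′) (λ c → ∑ (cube N) (power c))
  total-loss  = ∑ Λ (λ A → ∑ (cube N) (λ y → loss y A))

  -- Both totals evaluate the same sum `E` over layer, cube and coordinates: spectrally it yields
  -- the power, pointwise and with opposite sign the loss.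
  balance : total-power ℤ.+ 2^ N ℤ.* total-loss ≡ 0ℤ
  balance = begin
    total-power ℤ.+ 2^ N ℤ.* total-loss
      ≡⟨ cong₂ (λ u v → u ℤ.+ 2^ N ℤ.* v) power-total loss-total ⟩
    2^ N ℤ.* E ℤ.+ 2^ N ℤ.* (-1ℤ ℤ.* E)
      ≡⟨ cancel (2^ N) E ⟩
    0ℤ ∎
    where
    open ≡-Reasoning
    e : Fin n′ → Vec Bool N → Vec Bool (suc N) → ℤ
    e c = energy k l k+l≡ a (f c)
    E = ∑ Λ (λ A → ∑ (cube N) (λ y → ∑ (allFin n′) (λ c → e c y A)))
    cancel : ∀ p e → p ℤ.* e ℤ.+ p ℤ.* (-1ℤ ℤ.* e) ≡ 0ℤ
    cancel = solve-∀
    power-total : total-power ≡ 2^ N ℤ.* E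
    power-total = begin
      ∑ (allFin n′) (λ c → ∑ (cube N) (power c))
        ≡⟨ ∑-cong (allFin n′) (λ c → energy-spectrum k l k+l≡ a (f c)) ⟩
      ∑ (allFin n′) (λ c → 2^ N ℤ.* ∑ Λ (λ A → ∑ (cube N) (λ y → e c y A)))
        ≡⟨ ∑-*ˡ (allFin n′) (2^ N) _ ⟩
      2^ N ℤ.* ∑ (allFin n′) (λ c → ∑ Λ (λ A → ∑ (cube N) (λ y → e c y A)))
        ≡⟨ cong (ℤ._*_ (2^ N)) (trans (∑-swap (allFin n′) Λ _)
             (∑-cong Λ (λ A → ∑-swap (allFin n′) (cube N) _))) ⟩
      2^ N ℤ.* E ∎
    loss-total : total-loss ≡ -1ℤ ℤ.* E
    loss-total = begin
      ∑ Λ (λ A → ∑ (cube N) (λ y → loss y A))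
        ≡⟨ ∑-cong Λ (λ A → ∑-cong (cube N) (λ y → cong (ℤ._*_ -1ℤ) (sym (∑-energy y A)))) ⟩
      ∑ Λ (λ A → ∑ (cube N) (λ y → -1ℤ ℤ.* ∑ (allFin n′) (λ c → e c y A)))
        ≡⟨ ∑-cong Λ (λ A → ∑-*ˡ (cube N) -1ℤ _) ⟩
      ∑ Λ (λ A → -1ℤ ℤ.* ∑ (cube N) (λ y → ∑ (allFin n′) (λ c → e c y A)))
        ≡⟨ ∑-*ˡ Λ -1ℤ _ ⟩
      -1ℤ ℤ.* E ∎
      where
      ∑-energy : ∀ y A → ∑ (allFin n′) (λ c → e c y A) ≡
                 + n ℤ.* gram (ψ y) (ψ (y ⊕ tail A)) ℤ.+ + a ℤ.* gram (ψ y) (ψ y)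
      ∑-energy y A = trans (∑-+ (allFin n′) _ _)
        (cong₂ ℤ._+_ (∑-*ˡ (allFin n′) (+ n) _) (∑-*ˡ (allFin n′) (+ a) _))

  -- Both totals are nonnegative, so balance makes every power and every loss vanish.

  vanishing : total-power ≡ 0ℤ × 2^ N ℤ.* total-loss ≡ 0ℤ
  vanishing = nonneg-sum≡0
    (∑-nonneg (allFin n′) (λ {c} _ → ∑-nonneg (cube N) (λ {S} _ → power≥0 c S)))
    (subst (ℤ._≤ 2^ N ℤ.* total-loss) (ℤ.*-zeroʳ (2^ N)) (ℤ.*-monoˡ-≤-nonNeg (2^ N) total-loss≥0))
    balance
    where
    total-loss≥0 : 0ℤ ℤ.≤ total-loss
    total-loss≥0 = ∑-nonneg Λ (λ A∈ → ∑-nonneg (cube N) (λ {y} _ → loss≥0 y A∈))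

  power≡0 : ∀ c S → power c S ≡ 0ℤ
  power≡0 c S = ∑-nonneg≡0 (cube N) (λ {S} _ → power≥0 c S)
    (∑-nonneg≡0 (allFin n′) (λ {c} _ → ∑-nonneg (cube N) (λ {S} _ → power≥0 c S)) (proj₁ vanishing) (∈-allFin c))
    (∈-cube S)

  loss≡0 : ∀ y A → weight A ≡ k → loss y A ≡ 0ℤ
  loss≡0 y A wt = ∑-nonneg≡0 (cube N) (λ {y} _ → loss≥0 y A∈)
    (∑-nonneg≡0 Λ (λ A∈ → ∑-nonneg (cube N) (λ {y} _ → loss≥0 y A∈)) total≡0 A∈) (∈-cube y)
    where
    total≡0 : total-loss ≡ 0ℤ
    total≡0 = cancel-nonzero (2^ N) total-loss (proj₂ vanishing) (2^≢0 N)
    A∈ : A ∈ Λ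
    A∈ = subst₂ (λ p q → A ∈ layer (suc N) p q) wt
      (ℕ.+-cancelˡ-≡ k _ _ (trans (cong (_+ zeros A) (sym wt)) (trans (weight+zeros A) (sym k+l≡)))) (∈-layer A)

  positive-gap : ∀ c S → 0ℤ ℤ.< gap S → walsh (f c) S ≡ 0ℤ
  positive-gap c S gap>0 = square-factor (walsh (f c) S) (gap S) (power≡0 c S) gap>0

  -- Either the gap is positive and the coefficient vanishes, or S is a single coordinate or the set
  -- of all retained coordinates, and then its character is a coordinate character.
  walsh-χ-linear : ∀ c S → IsLinear (λ z → walsh (f c) S ℤ.* χ S z)
  walsh-χ-linear c S = cases (weight S) (zeros S) refl refl
    where
    0-linear : walsh (f c) S ≡ 0ℤ → IsLinear (λ z → walsh (f c) S ℤ.* χ S z)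
    0-linear eq = replicate (suc N) 0ℤ ,
      λ z → trans (cong (ℤ._* χ S z) eq) (sym (linear-0 (complete z)))
    cases : ∀ p q → weight S ≡ p → zeros S ≡ q → IsLinear (λ z → walsh (f c) S ℤ.* χ S z)
    cases zero          q       p≡ q≡ = 0-linear (positive-gap c S
      (subst (λ p → 0ℤ ℤ.< eigengap a p (suc (zeros S)) k l) (sym p≡) (eigengap-0 2≤a k≡l+a (suc (zeros S)))))
    cases (suc zero)    q       p≡ q≡ = IsLinear-*ˡ (walsh (f c) S) (χ-linear-1 S p≡)
    cases (suc (suc p)) zero    p≡ q≡ = IsLinear-*ˡ (walsh (f c) S) (χ-linear-0 S q≡)
    cases (suc (suc p)) (suc q) p≡ q≡ = 0-linear (positive-gap c S
      (subst₂ (λ p q → 0ℤ ℤ.< eigengap a p (suc q) k l) (sym p≡) (sym q≡)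
        (eigengap-pos 2≤a k≡l+a p q 0<l (subst₂ (λ p q → p + suc q ≡ n) p≡ q≡ (type≡ S)))))

  f-linear : ∀ c → IsLinear (λ z → 2^ N ℤ.* f c z)
  f-linear c with IsLinear-∑ (cube N) (walsh-χ-linear c)
  ... | α , ∑≗ = α , λ z → trans (sym (walsh-inversion (f c) z)) (∑≗ z)

  gram-linear : ∀ y → IsLinear (λ z → + n ℤ.* (2^ N ℤ.* gram (ψ y) (ψ z)))
  gram-linear y with IsLinear-*ˡ (+ n) (IsLinear-∑ (allFin n′) (λ c → IsLinear-*ˡ (f c y) (f-linear c)))
  ... | α , ∑≗ = α , λ z → trans (cong (ℤ._*_ (+ n))
    (trans (sym (∑-*ˡ (allFin n′) (2^ N) _)) (∑-cong (allFin n′) (λ c → pull (2^ N) (f c y) (f c z))))) (∑≗ z)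
    where
    pull : ∀ p u v → p ℤ.* (u ℤ.* v) ≡ u ℤ.* (p ℤ.* v)
    pull = solve-∀

  scaling : ∀ y B → parity B ≡ false → n * hamming (ψ y) (ψ (y ⊕ tail B)) ≡ n′ * weight B
  scaling y B B-even with gram-linear y
  ... | α , gram≗ = conclude
    where
    open ≡-Reasoning
    -- Twisting the coefficients by the signs of `complete y` turns the value at a translate by B
    -- into a value at B itself.
    β = zipWith (λ u b → u ℤ.* sgn b) α (complete y)
    gram-β : ∀ B → parity B ≡ false → + n ℤ.* (2^ N ℤ.* gram (ψ y) (ψ (y ⊕ tail B))) ≡ linear β B
    gram-β B even = trans (gram≗ (y ⊕ tail B))
      (trans (cong (linear α) (complete-⊕ y B even)) (linear-⊕ α (complete y) B))
    at-layer : ∀ A → weight A ≡ k → linear β A ≡ 2^ N ℤ.* (ℤ.- (+ a ℤ.* + n′))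
    at-layer A wt = begin
      linear β A                                            ≡⟨ gram-β A (k-even A wt) ⟨
      + n ℤ.* (2^ N ℤ.* g)                                  ≡⟨ isolate (+ n) (2^ N) g (+ a) (gram (ψ y) (ψ y)) ⟩
      2^ N ℤ.* (ℤ.- (+ a ℤ.* gram (ψ y) (ψ y)) ℤ.- loss y A)
        ≡⟨ cong₂ (λ u v → 2^ N ℤ.* (ℤ.- (+ a ℤ.* u) ℤ.- v)) (gram-self (ψ y)) (loss≡0 y A wt) ⟩
      2^ N ℤ.* (ℤ.- (+ a ℤ.* + n′) ℤ.- 0ℤ)                  ≡⟨ cong (ℤ._*_ (2^ N)) (ℤ.+-identityʳ _) ⟩
      2^ N ℤ.* (ℤ.- (+ a ℤ.* + n′))                         ∎
      where
      g = gram (ψ y) (ψ (y ⊕ tail A))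
      isolate : ∀ n p g a s → n ℤ.* (p ℤ.* g) ≡ p ℤ.* (ℤ.- (a ℤ.* s) ℤ.- (-1ℤ ℤ.* (n ℤ.* g ℤ.+ a ℤ.* s)))
      isolate = solve-∀
    0<k : 0 < k
    0<k = subst (0 <_) (sym k≡l+a) (ℕ.<-≤-trans 0<l (ℕ.m≤m+n l a))
    balanced = linear-balanced β k _ 0<k
      (subst (k <_) k+l≡ (ℕ.m<m+n k 0<l)) at-layer
    w = proj₁ balanced
    -- The common coefficient w is read off at B = 𝟎, where the Gram function takes its known value
    -- n′.
    at-𝟎 : + n ℤ.* (2^ N ℤ.* + n′) ≡ w ℤ.* (+ n ℤ.- 0ℤ)
    at-𝟎 = begin
      + n ℤ.* (2^ N ℤ.* + n′)
        ≡⟨ cong (λ t → + n ℤ.* (2^ N ℤ.* t)) (trans (cong (λ z → gram (ψ y) (ψ z)) (⊕-identityʳ y)) (gram-self (ψ y))) ⟨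
      + n ℤ.* (2^ N ℤ.* gram (ψ y) (ψ (y ⊕ tail (𝟎 {suc N}))))
        ≡⟨ gram-β 𝟎 (parity-𝟎 (suc N)) ⟩
      linear β 𝟎                                          ≡⟨ proj₂ balanced 𝟎 ⟩
      w ℤ.* (+ suc N ℤ.- + 2 ℤ.* + weight (𝟎 {suc N}))
        ≡⟨ cong₂ (λ u v → w ℤ.* (+ u ℤ.- + 2 ℤ.* + v)) (sym k+l≡) (weight-𝟎 (suc N)) ⟩
      w ℤ.* (+ n ℤ.- 0ℤ)                                  ∎
    nonZero : ℤ.NonZero (+ n)
    nonZero = subst (λ t → ℤ.NonZero (+ t)) (sym k+l≡) _
    w≡ : 2^ N ℤ.* + n′ ≡ w
    w≡ = ℤ.*-cancelˡ-≡ (+ n) _ w {{nonZero}} (trans at-𝟎 (trans (cong (ℤ._*_ w) (ℤ.+-identityʳ (+ n))) (ℤ.*-comm w (+ n))))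
    D = hamming (ψ y) (ψ (y ⊕ tail B))
    conclude : n * D ≡ n′ * weight B
    conclude = ℤ.+-injective (trans (ℤ.pos-* n D) (trans
      (ℤ.*-cancelˡ-≡ (2^ N ℤ.* + 2) _ _ {{ℤ.≢-nonZero nonzero}} (begin
        2^ N ℤ.* + 2 ℤ.* (+ n ℤ.* + D)
          ≡⟨ left (2^ N) (+ n) (+ D) (+ n′) ⟩
        2^ N ℤ.* + n′ ℤ.* + n ℤ.- + n ℤ.* (2^ N ℤ.* (+ n′ ℤ.- + 2 ℤ.* + D))
          ≡⟨ cong (λ t → 2^ N ℤ.* + n′ ℤ.* + n ℤ.- t) value-at-B ⟩
        2^ N ℤ.* + n′ ℤ.* + n ℤ.- 2^ N ℤ.* + n′ ℤ.* (+ n ℤ.- + 2 ℤ.* + weight B)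
          ≡⟨ right (2^ N) (+ n) (+ weight B) (+ n′) ⟩
        2^ N ℤ.* + 2 ℤ.* (+ n′ ℤ.* + weight B) ∎))
      (sym (ℤ.pos-* n′ (weight B)))))
      where
      left : ∀ p n d n′ → p ℤ.* + 2 ℤ.* (n ℤ.* d) ≡ p ℤ.* n′ ℤ.* n ℤ.- n ℤ.* (p ℤ.* (n′ ℤ.- + 2 ℤ.* d))
      left = solve-∀
      right : ∀ p n b n′ → p ℤ.* n′ ℤ.* n ℤ.- p ℤ.* n′ ℤ.* (n ℤ.- + 2 ℤ.* b) ≡ p ℤ.* + 2 ℤ.* (n′ ℤ.* b)
      right = solve-∀
      nonzero : 2^ N ℤ.* + 2 ≢ 0ℤ
      nonzero eq with () ← cancel-nonzero (2^ N) (+ 2) eq (2^≢0 N)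
      value-at-B : + n ℤ.* (2^ N ℤ.* (+ n′ ℤ.- + 2 ℤ.* + D)) ≡ 2^ N ℤ.* + n′ ℤ.* (+ n ℤ.- + 2 ℤ.* + weight B)
      value-at-B = begin
        + n ℤ.* (2^ N ℤ.* (+ n′ ℤ.- + 2 ℤ.* + D))
          ≡⟨ cong (λ t → + n ℤ.* (2^ N ℤ.* t)) (gram-hamming (ψ y) (ψ (y ⊕ tail B))) ⟨
        + n ℤ.* (2^ N ℤ.* gram (ψ y) (ψ (y ⊕ tail B)))   ≡⟨ gram-β B B-even ⟩
        linear β B                                       ≡⟨ proj₂ balanced B ⟩
        w ℤ.* (+ suc N ℤ.- + 2 ℤ.* + weight B)
          ≡⟨ cong₂ (λ u v → u ℤ.* (+ v ℤ.- + 2 ℤ.* + weight B)) (sym w≡) (sym k+l≡) ⟩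
        2^ N ℤ.* + n′ ℤ.* (+ n ℤ.- + 2 ℤ.* + weight B)   ∎

-- Homomorphisms

parity-false⇒even : ∀ {m} (x : Vec Bool m) → parity x ≡ false → 2 ∣ weight x
parity-true⇒odd : ∀ {m} (x : Vec Bool m) → parity x ≡ true → 2 ∣ suc (weight x)

parity-false⇒even []          _  = 2 ∣0
parity-false⇒even (false ∷ x) eq = parity-false⇒even x eq
parity-false⇒even (true  ∷ x) eq = parity-true⇒odd x (trans (sym (𝔹.not-involutive (parity x))) (cong not eq))
parity-true⇒odd (false ∷ x) eq = parity-true⇒odd x eq
parity-true⇒odd (true  ∷ x) eq with parity-false⇒even x (trans (sym (𝔹.not-involutive (parity x))) (cong not eq))
... | divides q w≡ = divides (suc q) (cong (λ t → 2 + t) w≡)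

even⇒parity-false : ∀ {m} (x : Vec Bool m) → 2 ∣ weight x → parity x ≡ false
even⇒parity-false x even with parity x in eq
... | false = refl
... | true  with () ← ∣1⇒≡1 (∣m+n∣m⇒∣n (subst (2 ∣_) (sym (ℕ.+-comm (weight x) 1)) (parity-true⇒odd x eq)) even)

-- The evenness proof inside the refinement is irrelevant; equality of Booleans is decidable, so a
-- usable proof can be recomputed.
parity-value : ∀ {m} (x : EvenWeight m) → parity (value x) ≡ false
parity-value (x , [ even ]) = recompute (parity x 𝔹.≟ false) (even⇒parity-false x even)

completion : ∀ {m} → Vec Bool m → EvenWeight (suc m)
completion y = complete y , [ parity-false⇒even (complete y) (𝔹.xor-same (parity y)) ]

completion-tail : ∀ {m} (x : EvenWeight (suc m)) → completion (tail (value x)) ≡ x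
completion-tail x = value-injective (lem (value x) (parity-value x))
  where
  lem : ∀ {m} (v : Vec Bool (suc m)) → parity v ≡ false → complete (tail v) ≡ v
  lem (false ∷ y) eq = cong (_∷ y) eq
  lem (true  ∷ y) eq = cong (_∷ y) (trans (sym (𝔹.not-involutive (parity y))) (cong not eq))

⊕-cancel : ∀ {m} (x y : Vec Bool m) → x ⊕ (x ⊕ y) ≡ y
⊕-cancel []          []      = refl
⊕-cancel (false ∷ x) (b ∷ y) = cong (b ∷_) (⊕-cancel x y)
⊕-cancel (true  ∷ x) (b ∷ y) = cong₂ _∷_ (𝔹.not-involutive b) (⊕-cancel x y)

hamming≡0⇒≡ : ∀ {m} (x y : Vec Bool m) → hamming x y ≡ 0 → x ≡ y
hamming≡0⇒≡ []          []          _  = refl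
hamming≡0⇒≡ (false ∷ x) (false ∷ y) eq = cong (false ∷_) (hamming≡0⇒≡ x y eq)
hamming≡0⇒≡ (true  ∷ x) (true  ∷ y) eq = cong (true ∷_) (hamming≡0⇒≡ x y eq)

-- Every even-weight vector is the completion of its tail, so a finite search through the cube one
-- dimension lower is exhaustive.
∃-completion? : ∀ {m} {P : EvenWeight (suc m) → Set} → (∀ x → Dec (P x)) → Dec (∃[ x ] P x)
∃-completion? {m} {P} P? = map′
  (λ any → let y , py = satisfied any in completion y , py)
  (λ { (x , px) → lose (∈-cube (tail (value x))) (subst P (sym (completion-tail x)) px) })
  (any? (λ y → P? (completion y)) (cube m))

-- The edges are those of the image of G, not all the edges that H has between image vertices.

injective⇒subgraph : {V W : Set} {G : Graph V} {H : Graph W} (φ : Hom G H) → IsInjective φ →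
  (∀ w → Dec (∃[ x ] fun φ x ≡ w)) → IsomorphicToSubgraphOf G H
injective⇒subgraph {V} {W} {G} {H} φ inj image? = image , record
  { bijection = mk↔ₛ′ to from
      (λ w → value-injective (proj₂ (preimage w)))
      (λ x → inj (proj₂ (preimage (to x))))
  ; adjacency = λ x y → mk⇔ (λ xy → x , y , refl , refl , xy)
      (λ { (x′ , y′ , x′≡ , y′≡ , x′y′) → subst₂ (Adj G) (inj x′≡) (inj y′≡) x′y′ })
  }
  where
  Image : Set
  Image = Refinement W (λ w → ∃[ x ] fun φ x ≡ w)
  preimage : (w : Image) → ∃[ x ] fun φ x ≡ value w
  -- Irrelevant membership cannot yield a vertex; the decision procedure finds one again, and
  -- injectivity later identifies it with the original.
  preimage (w , [ ∃x ]) = recompute (image? w) ∃x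
  to : V → Image
  to x = fun φ x , [ x , refl ]
  from : Image → V
  from w = proj₁ (preimage w)
  AdjI : Image → Image → Set
  AdjI u v = ∃[ x ] ∃[ y ] (fun φ x ≡ value u × fun φ y ≡ value v × Adj G x y)
  image : Subgraph H
  image = record
    { vertices = λ w → ∃[ x ] fun φ x ≡ w
    ; graph    = record
        { Adj    = AdjI
        ; symm   = λ { (x , y , x≡ , y≡ , xy) → y , x , y≡ , x≡ , symm G xy }
        ; irrefl = λ { (x , y , x≡ , y≡ , xy) → irrefl G (subst (Adj G x) (inj (trans y≡ (sym x≡))) xy) }
        }
    ; edges    = λ { (x , y , x≡ , y≡ , xy) → subst₂ (Adj H) x≡ y≡ (preserves φ xy) }
    }

module _ {N n′ k k′ : ℕ} .{{_ : NonZero k}} .{{_ : NonZero k′}} {G : Graph (EvenWeight (suc N))} {G′ : Graph (EvenWeight n′)}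
  (k+2≤ : 2 + suc N ≤ k + k) (k<n : k < suc N) (ratio : suc N * k′ ≡ n′ * k) (2∣k : 2 ∣ k)
  (H⊆G : H (suc N) k ⊆ G) (G′⊆H′ : G′ ⊆ H′ n′ k′) where

  dist-scaling : (φ : Hom G G′) → ∀ x y → suc N * dist (fun φ x) (fun φ y) ≡ n′ * dist x y
  dist-scaling φ x y = begin
    suc N * dist (fun φ x) (fun φ y)
      ≡⟨ cong₂ (λ u v → suc N * dist (fun φ u) (fun φ v)) (completion-tail x)
           (trans (cong completion (tail-⊕ (value x) (value y))) (completion-tail y)) ⟨
    suc N * hamming (ψ (tail (value x))) (ψ (tail (value x) ⊕ tail (value x ⊕ value y)))
      ≡⟨ cong (_* hamming (ψ (tail (value x))) (ψ (tail (value x) ⊕ tail (value x ⊕ value y)))) k+l≡ ⟨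
    (k + l) * hamming (ψ (tail (value x))) (ψ (tail (value x) ⊕ tail (value x ⊕ value y)))
      ≡⟨ scaling (tail (value x)) (value x ⊕ value y)
           (trans (parity-⊕ (value x) (value y)) (cong₂ _xor_ (parity-value x) (parity-value y))) ⟩
    n′ * dist x y ∎
    where
    open ≡-Reasoning
    -- With n = `suc N`, these are l = n - k and a = 2k - n; the hypothesis `k+2≤` amounts to a ≥ 2.
    l a : ℕ
    l = suc N ∸ k
    a = k ∸ l
    k+l≡ : k + l ≡ suc N
    k+l≡ = ℕ.m+[n∸m]≡n (ℕ.<⇒≤ k<n)
    2+l≤k : 2 + l ≤ k
    2+l≤k = ℕ.+-cancelˡ-≤ k _ _ (subst (_≤ k + k)
      (trans (cong (λ t → 2 + t) (sym k+l≡)) (lem k l)) k+2≤)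
      where
      lem : ∀ k l → 2 + (k + l) ≡ k + (2 + l)
      lem = ℕ-Solver.solve-∀
    k≡l+a : k ≡ l + a
    k≡l+a = sym (ℕ.m+[n∸m]≡n (ℕ.≤-trans (ℕ.m≤n+m l 2) 2+l≤k))
    ψ : Vec Bool N → Vec Bool n′
    ψ v = value (fun φ (completion v))
    -- For even A the two completions differ by exactly A, so weight k makes them an edge of
    -- `H (suc N) k`.
    far : ∀ v A → weight A ≡ k → k′ ≤ hamming (ψ v) (ψ (v ⊕ tail A))
    far v A wt = G′⊆H′ (preserves φ (H⊆G (trans (cong weight
      (trans (cong (complete v ⊕_) (complete-⊕ v A (even⇒parity-false A (subst (2 ∣_) (sym wt) 2∣k))))
        (⊕-cancel (complete v) A))) wt)))
    tail-⊕ : ∀ {m} (u v : Vec Bool (suc m)) → tail u ⊕ tail (u ⊕ v) ≡ tail v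
    tail-⊕ (_ ∷ u) (_ ∷ v) = ⊕-cancel u v
    open Isometry {a = a} (ℕ.m+n≤o⇒m≤o∸n 2 2+l≤k) (ℕ.m<n⇒0<n∸m k<n) k≡l+a k+l≡
      (λ A wt → even⇒parity-false A (subst (2 ∣_) (sym wt) 2∣k))
      (trans (ℕ.*-comm k n′) (trans (sym ratio) (trans (ℕ.*-comm (suc N) k′) (cong (k′ *_) (sym k+l≡)))))
      ψ far

  hom-injective : (φ : Hom G G′) → IsInjective φ
  hom-injective φ {x} {y} φx≡φy = value-injective (hamming≡0⇒≡ (value x) (value y) dist≡0)
    where
    n′≢0 : n′ ≢ 0
    n′≢0 refl = ≢-nonZero⁻¹ (suc N * k′) {{ℕ.m*n≢0 (suc N) k′}} ratio
    scaled≡0 : n′ * dist x y ≡ 0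
    scaled≡0 = trans (sym (dist-scaling φ x y)) (trans
      (cong (suc N *_) (trans (cong (λ w → hamming (value (fun φ x)) (value w)) (sym φx≡φy))
        (hamming-refl (value (fun φ x))))) (ℕ.*-zeroʳ (suc N)))
    dist≡0 : dist x y ≡ 0
    dist≡0 = [ ⊥-elim ∘ n′≢0 , id ]′ (ℕ.m*n≡0⇒m≡0∨n≡0 n′ scaled≡0)

hom⇒multiples : ∀ {n n′ k k′} .{{_ : NonZero n}} → 1 < n → n * k′ ≡ n′ * k →
  (F : EvenWeight n → EvenWeight n′) → (∀ x y → n * dist (F x) (F y) ≡ n′ * dist x y) → n ∣ n′ × k ∣ k′
hom⇒multiples {suc zero} (s≤s ())
hom⇒multiples {n@(suc (suc M))} {n′} {k} {k′} _ ratio F scaled = from-even even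
  where
  x₀ x₂ : EvenWeight n
  x₀ = 𝟎 , [ subst (2 ∣_) (sym (weight-𝟎 n)) (2 ∣0) ]
  x₂ = true ∷ true ∷ 𝟎 , [ subst (λ w → 2 ∣ 2 + w) (sym (weight-𝟎 M)) (divides-refl 1) ]
  dist≡2 : dist x₀ x₂ ≡ 2
  dist≡2 = cong (λ t → 2 + t) (hamming-refl (𝟎 {M}))
  even : 2 ∣ dist (F x₀) (F x₂)
  even = parity-false⇒even (value (F x₀) ⊕ value (F x₂)) (trans (parity-⊕ (value (F x₀)) (value (F x₂)))
    (cong₂ _xor_ (parity-value (F x₀)) (parity-value (F x₂))))
  from-even : 2 ∣ dist (F x₀) (F x₂) → n ∣ n′ × k ∣ k′
  from-even (divides q eq) = divides q (trans (sym nq≡n′) (ℕ.*-comm n q)) , divides q k′≡qk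
    where
    nq≡n′ : n * q ≡ n′
    nq≡n′ = ℕ.*-cancelʳ-≡ (n * q) n′ 2 (trans (ℕ.*-assoc n q 2) (trans (cong (n *_) (sym eq))
      (trans (scaled x₀ x₂) (cong (n′ *_) dist≡2))))
    k′≡qk : k′ ≡ q * k
    k′≡qk = ℕ.*-cancelˡ-≡ k′ (q * k) n (trans ratio (trans (cong (_* k) (sym nq≡n′)) (ℕ.*-assoc n q k)))

theorem5p4 : (n k n′ k′ : ℕ) .{{_ : NonZero k}} .{{_ : NonZero k′}} →
    (+ (n + 1)) / 2 <ℚ (+ k) / 1 →
    k < n →
    (+ n) / k ≃ (+ n′) / k′ →
    2 ∣ k →
    2 ∣ k′ →
    (G : Graph (EvenWeight n)) (G′ : Graph (EvenWeight n′)) →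
    H n k ⊆ G → G ⊆ H′ n k →
    H n′ k′ ⊆ G′ → G′ ⊆ H′ n′ k′ →
    Hom G G′ →
    (n ∣ n′ × k ∣ k′) × ((φ : Hom G G′) → IsInjective φ) × IsomorphicToSubgraphOf G G′
theorem5p4 n@(suc N) k@(suc k₋) n′ k′@(suc k′₋) (*<* n+1<2k) k<n (*≡* n/k≡n′/k′) 2∣k 2∣k′ G G′ H⊆G G⊆H′ H′⊆G′ G′⊆H′ φ =
  hom⇒multiples (ℕ.≤-trans (s≤s (s≤s z≤n)) k<n) ratio (fun φ) (dist-scaling bound k<n ratio 2∣k H⊆G G′⊆H′ φ) ,
  injective ,
  injective⇒subgraph φ (injective φ)
    (λ w → ∃-completion? (λ x → Refinement._≟_ (≡-dec 𝔹._≟_) (fun φ x) w))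
  where
  ratio : n * k′ ≡ n′ * k
  ratio = ℤ.+-injective (trans (ℤ.pos-* n k′) (trans n/k≡n′/k′ (sym (ℤ.pos-* n′ k))))
  -- Cross-multiplication gives n + 1 < 2k; over the integers the strict inequality gains one more
  -- unit.
  bound : 2 + n ≤ k + k
  bound = subst₂ _≤_ (lem₁ n) (lem₂ k)
    (ℤ.drop‿+<+ (subst₂ ℤ._<_ (sym (ℤ.pos-* (n + 1) 1)) (sym (ℤ.pos-* k 2)) n+1<2k))
    where
    lem₁ : ∀ n → suc ((n + 1) * 1) ≡ 2 + n
    lem₁ = ℕ-Solver.solve-∀
    lem₂ : ∀ k → k * 2 ≡ k + k
    lem₂ = ℕ-Solver.solve-∀
  injective : (φ : Hom G G′) → IsInjective φ
  injective = hom-injective bound k<n ratio 2∣k H⊆G G′⊆H′
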